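{- Let $S$ be a string, let $z$ be the number of LZ77-factors of $S$, and let $q$ be a natural number such that $S$ does not contain $q$-th powers. Then the number of right extensions of maximal repeats in $S$ is bounded from above by $$18q(1+\log_q |S|)(z+2)^2-(z+1).$$ Also, the compacted directed acyclic word graph (CDAWG) of $S$ has at most $$18q(1+\log_q |S|)(z+2)^2$$ arcs.
   Context: A string $S=S[1]S[2]\cdots S[|S|]$ is a finite sequence of characters from an alphabet $\Sigma$. One sets $S[0]=S[|S|+1]=\$$ for a symbol $\$\notin\Sigma$, and $S\$$ denotes $S[1]\cdots S[|S|]S[|S|+1]$. A $q$-th power is a string of the form $w^q$ with $w$ nonempty. The (self-referential) LZ77-decomposition of $S$ is the factorization $S=F_1F_2\cdots F_z$ such that, for each $i$, either $F_i$ is a single character which does not occur in $F_1\cdots F_{i-1}$, or $F_i$ is the longest possible prefix of $S[|F_1\cdots F_{i-1}|+1..|S|]$ which occurs at least twice in $F_1\cdots F_i$. The $F_i$ are the LZ77-factors and $z$ is their number. A maximal repeat of $S$ is a (nonempty) substring $P$ of $S$ which occurs at least twice in $S$ and such that every extension of $P$ (to the left or to the right, where the delimiters $S[0]$ and $S[|S|+1]$ are taken into account) occurs less often than $P$. A right extension of a maximal repeat $P$ is a string $Pa$ with $a\in\Sigma\cup\{\$\}$ which occurs in $S\$$. The number of right extensions of maximal repeats is the number of distinct such strings, over all maximal repeats $P$. The CDAWG of $S$ is the compacted directed acyclic word graph of $S\$$, i.e. the edge-labelled directed acyclic graph obtained from the suffix tree of $S\$$ by merging isomorphic subtrees (all leaves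 being merged into one sink). Its internal nodes other than the root correspond bijectively to the (nonempty) maximal repeats of $S$, and the root corresponds to the empty string. -}

module Defs where

open import Level using (Level; _⊔_)
open import Data.Nat using (ℕ; _+_; _*_; _^_; _≤_; _<_)
open import Data.List using (List; []; _∷_; [_]; _++_; _∷ʳ_; map; concat; replicate; filter; tails; length)
open import Data.List.Membership.Propositional using (_∉_)
open import Data.List.Relation.Unary.All using (All)
open import Data.List.Relation.Unary.AllPairs using (AllPairs)
open import Data.List.Relation.Binary.Prefix.Heterogeneous using (Prefix)
open import Data.List.Relation.Binary.Prefix.Heterogeneous.Properties using (prefix?)
open import Data.List.Relation.Binary.Suffix.Heterogeneous using (Suffix)
open import Data.List.Relation.Binary.Infix.Heterogeneous using (Infix)
open import Data.Maybe using (Maybe; just; nothing)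
open import Data.Maybe.Properties using (≡-dec)
open import Data.Product using (_×_; _,_; ∃₂; ∃-syntax)
open import Data.Sum using (_⊎_)
open import Relation.Nullary using (¬_)
open import Relation.Binary.Core using (Rel)
open import Relation.Binary.Definitions using (DecidableEquality)
open import Relation.Binary.PropositionalEquality using (_≡_; _≢_)
open import Relation.Binary.Construct.Closure.ReflexiveTransitive using (Star)

private
  variable
    a p r e : Level
    A : Set a

-- x ≤ c · (1 + log_q n) over the reals, for q ≥ 2 and n ≥ 1, after applying
-- the order isomorphism t ↦ q ^ t to both sides.  For q ≤ 1 or n ≡ 0, where
-- log_q n is undefined, this has no meaning as a logarithmic inequality.
infix 4 _≤_·[1+log_of_]

_≤_·[1+log_of_] : ℕ → ℕ → ℕ → ℕ → Set
x ≤ c ·[1+log q of n ] = q ^ x ≤ q ^ c * n ^ c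

-- B holds for the length of every list of pairwise ≈-inequivalent elements
-- of P.  For B n of the form "n is at most β" this says that P has at most β
-- elements up to ≈.
Number : {A : Set a} → (A → Set p) → Rel A r → (ℕ → Set) → Set (a ⊔ p ⊔ r)
Number P _≈_ B =
  ∀ xs → All P xs → AllPairs (λ x y → ¬ (x ≈ y)) xs → B (length xs)

infixr 8 _^ʷ_

_^ʷ_ : List A → ℕ → List A
w ^ʷ q = concat (replicate q w)

PowerFree : {A : Set a} → ℕ → List A → Set a
PowerFree q S = ∀ w → w ≢ [] → ¬ Infix _≡_ (w ^ʷ q) S

-- Strings over the alphabet extended by the delimiter $ are lists over
-- Maybe A, with nothing playing the role of $.

-- S$
terminated : List A → List (Maybe A)
terminated S = map just S ∷ʳ nothing

-- $S$
delimited : List A → List (Maybe A)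
delimited S = nothing ∷ terminated S

module _ {a} {A : Set a} (_≟_ : DecidableEquality A) where

  -- The number of positions of T at which P starts; overlapping occurrences
  -- are all counted.
  occ : List A → List A → ℕ
  occ P T = length (filter (prefix? _≟_ P) (tails T))

  data IsLZ77Factor (done F rest : List A) : Set a where
    fresh  : ∀ c → F ≡ [ c ] → c ∉ done → IsLZ77Factor done F rest
    copied : F ≢ [] →
             2 ≤ occ F (done ++ F) →
             (∀ G → Prefix _≡_ G (F ++ rest) → 2 ≤ occ G (done ++ G) →
                length G ≤ length F) →
             IsLZ77Factor done F rest

  record IsLZ77 (S : List A) (Fs : List (List A)) : Set a where
    field
      factorization : concat Fs ≡ S
      factors       : ∀ Fs₁ F Fs₂ → Fs ≡ Fs₁ ++ F ∷ Fs₂ →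
                      IsLZ77Factor (concat Fs₁) F (concat Fs₂)

module _ {a} {A : Set a} (_≟_ : DecidableEquality A) where

  -- Only extensions by one character are considered; a longer extension
  -- occurs at most as often as a one-character extension that it contains.
  record IsMaximalRepeat (S P : List A) : Set a where
    field
      nonempty : P ≢ []
      repeated : 2 ≤ occ _≟_ P S
      left     : ∀ x → occ (≡-dec _≟_) (x ∷ map just P) (delimited S) < occ _≟_ P S
      right    : ∀ x → occ (≡-dec _≟_) (map just P ∷ʳ x) (delimited S) < occ _≟_ P S

  IsRightExtension : List A → List (Maybe A) → Set a
  IsRightExtension S Q =
    ∃₂ λ P x → IsMaximalRepeat S P × Q ≡ map just P ∷ʳ x × Infix _≡_ Q (terminated S)

-- An edge-labelled graph is given by its set E of arcs (source , label ,
-- target).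
module Merging {V : Set a} {L : Set p} (E : V × L × V → Set e) where

  Descendant : V → V → Set (a ⊔ p ⊔ e)
  Descendant = Star (λ u v → ∃[ x ] E (u , x , v))

  -- Isomorphism of the edge-labelled subtrees rooted at u and at v.  The maps
  -- are defined on all of V, but only their values on descendants matter.
  record _≅_ (u v : V) : Set (a ⊔ p ⊔ e) where
    field
      to        : V → V
      from      : V → V
      to-root   : to u ≡ v
      from-root : from v ≡ u
      to-desc   : ∀ {w} → Descendant u w → Descendant v (to w)
      from-desc : ∀ {w} → Descendant v w → Descendant u (from w)
      from-to   : ∀ {w} → Descendant u w → from (to w) ≡ w
      to-from   : ∀ {w} → Descendant v w → to (from w) ≡ w
      to-arc    : ∀ {w x w′} → Descendant u w →
                  E (w , x , w′) → E (to w , x , to w′)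
      from-arc  : ∀ {w x w′} → Descendant v w →
                  E (w , x , w′) → E (from w , x , from w′)

  -- When the roots of isomorphic subtrees are identified, these are the pairs
  -- of arcs that become one arc.
  _≈_ : Rel (V × L × V) (a ⊔ p ⊔ e)
  (u , x , v) ≈ (u′ , x′ , v′) = u ≅ u′ × x ≡ x′ × v ≅ v′

-- The suffix tree of T, whose last character is assumed to occur only once:
-- the trie of the suffixes of T in which only the root, the branching nodes and
-- the leaves are kept.  A node is represented by the string spelled on the path
-- from the root to it.
module SuffixTree {A : Set a} (T : List A) where

  IsLeaf : List A → Set a
  IsLeaf u = u ≢ [] × Suffix _≡_ u T

  IsBranching : List A → Set a
  IsBranching u =
    ∃₂ λ x y → x ≢ y × Infix _≡_ (u ∷ʳ x) T × Infix _≡_ (u ∷ʳ y) T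

  IsNode : List A → Set a
  IsNode u = u ≡ [] ⊎ IsBranching u ⊎ IsLeaf u

  data IsArc : List A × List A × List A → Set a where
    arc : ∀ {u x v} → IsNode u → IsNode v → x ≢ [] → v ≡ u ++ x →
          (∀ y z → x ≡ y ++ z → y ≢ [] → z ≢ [] → ¬ IsNode (u ++ y)) →
          IsArc (u , x , v)

-- The CDAWG of S is the suffix tree of S$ with isomorphic subtrees merged, so
-- its arcs are those of the suffix tree up to SameCDAWGArc.
CDAWGArc : {A : Set a} (S : List A) →
           List (Maybe A) × List (Maybe A) × List (Maybe A) → Set a
CDAWGArc S = SuffixTree.IsArc (terminated S)

SameCDAWGArc : {A : Set a} (S : List A) →
               Rel (List (Maybe A) × List (Maybe A) × List (Maybe A)) a
SameCDAWGArc S = Merging._≈_ (CDAWGArc S)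

{-# OPTIONS --safe #-}
module Submission where

-- A right extension Pa of a maximal repeat P comes with occurrences of xPa and yPb
-- in $S$ where x ≢ y and b ≢ a, and the two can be moved so that each straddles one
-- of the z + 1 gaps between LZ77 factors (the delimiters count as factors).  The two
-- gaps g, g′ and the difference s of their offsets in P determine Pa, because both
-- occurrences are cut off by mismatches.  If s > 0, then the s characters before g
-- are the s characters after g′, so for fixed gaps the values of s are the lengths of
-- a chain of borders of one string; if s < 0, exchange the roles of the gaps.
--
-- A chain of borders of a string of length s without q-th powers has at most
-- 2q (1 + log_q s) members: if p is the least period of the longest one, then the
-- members of length at least p are p apart, so there are m ≤ s / p < q of them, and
-- the next one has length at most s / max(m, 2).  Since q ^ m ≤ max(m, 2) ^ (2q), the
-- estimate follows by induction.
--
-- Let l be the longest string that precedes all occurrences of a branching node u ≢ [].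
-- The subtrees at u and at lu are isomorphic, and the first character of an arc from u
-- gives a right extension of the maximal repeat lu.  The arcs leaving the root are told
-- apart by their first characters, each of which occurs right after some gap.

open import Defs
open import Level using (Level)
open import Data.Empty using (⊥)
open import Data.Nat hiding (_≟_)
open import Data.Nat.DivMod using (m≡m%n+[m/n]*n; m%n<n; m/n*n≤m)
open import Data.Nat.Induction using (<-rec)
open import Data.Nat.Properties renaming (_≟_ to _≟ℕ_)
open import Data.Nat.Tactic.RingSolver using (solve-∀)
open import Data.List using (List; []; _∷_; [_]; _++_; _∷ʳ_; length; map; concat; filter; cartesianProduct; take; drop; tails)
open import Data.List.Properties using (length-++; length-map; filter-accept; filter-reject; ++-assoc; ++-identityʳ; ++-conicalˡ; ++-conicalʳ; concat-++; ∷ʳ-injective)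
open import Data.List.Membership.Propositional using (_∈_)
open import Data.List.Membership.Propositional.Properties using (∈-cartesianProduct⁺)
open import Data.List.Relation.Unary.Any using (here; there)
open import Data.List.Relation.Unary.All as All using (All; []; _∷_)
import Data.List.Relation.Unary.All.Properties as All
open import Data.List.Relation.Unary.AllPairs as AllPairs using (AllPairs; []; _∷_)
import Data.List.Relation.Unary.AllPairs.Properties as AllPairs
open import Data.List.Relation.Unary.Linked.Properties using (Linked⇒AllPairs)
open import Data.List.Relation.Binary.Infix.Heterogeneous using (Infix; here; there)
open import Data.List.Relation.Binary.Prefix.Heterogeneous using (Prefix; []; _∷_)
open import Data.List.Relation.Binary.Prefix.Heterogeneous.Properties using (prefix?)
open import Data.List.Relation.Binary.Suffix.Heterogeneous using (Suffix; here; there)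
open import Data.List.Relation.Binary.Pointwise using (Pointwise-≡⇒≡; ≡⇒Pointwise-≡)
open import Data.Maybe as Maybe using (Maybe; just; nothing)
open import Data.Maybe.Properties using (just-injective; map-injective) renaming (≡-dec to Maybe-≡-dec)
open import Data.Product using (_×_; _,_; proj₁; proj₂; ∃; ∃₂)
open import Data.Product.Properties using (≡-dec)
open import Data.Sum using (_⊎_; inj₁; inj₂)
open import Data.Unit using (⊤; tt)
open import Function using (_∘_; id)
open import Relation.Nullary using (¬_; Dec; yes; no; contradiction; _×-dec_; _→-dec_)
open import Relation.Nullary.Decidable using (map′; ¬?)
open import Relation.Unary using (Pred; Decidable)
open import Relation.Binary.Core using (Rel)
open import Relation.Binary.Definitions using (DecidableEquality; tri<; tri≈; tri>)
open import Relation.Binary.Construct.Closure.ReflexiveTransitive using (Star; ε; _◅_; _◅◅_)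
import Relation.Binary.Construct.Flip.EqAndOrd as Flip
open import Relation.Binary.PropositionalEquality hiding ([_])
open import Data.List.Relation.Binary.Permutation.Propositional using (↭-sym; ↭⇒↭ₛ)
open import Data.List.Relation.Binary.Permutation.Propositional.Properties using (All-resp-↭; ↭-length)
open import Data.List.Relation.Binary.Permutation.Setoid.Properties (setoid ℕ) using (Unique-resp-↭)
open import Data.List.Sort (Flip.decTotalOrder ≤-decTotalOrder) using (sort; sort-↭; sort-↗)

private
  variable
    a b p r s t : Level
    X : Set a
    Y : Set b

-- Powers of natural numbers and least witnesses

^-distribʳ-* : ∀ m n k → (m * n) ^ k ≡ m ^ k * n ^ k
^-distribʳ-* m n zero    = refl
^-distribʳ-* m n (suc k) = begin
  m * n * (m * n) ^ k       ≡⟨ cong (m * n *_) (^-distribʳ-* m n k) ⟩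
  m * n * (m ^ k * n ^ k)   ≡⟨ [m*n]*[o*p]≡[m*o]*[n*p] m n (m ^ k) (n ^ k) ⟩
  m * m ^ k * (n * n ^ k)   ∎
  where open ≡-Reasoning

n<2^n : ∀ n → n < 2 ^ n
n<2^n zero    = s≤s z≤n
n<2^n (suc n) = begin-strict
  suc n            ≤⟨ n<2^n n ⟩
  2 ^ n            <⟨ m<m+n (2 ^ n) (m^n>0 2 n) ⟩
  2 ^ n + 2 ^ n    ≡⟨ cong (2 ^ n +_) (sym (+-identityʳ (2 ^ n))) ⟩
  2 ^ suc n        ∎
  where open ≤-Reasoning

-- With f = ⌊q / m⌋ we have q ≤ m (1 + f) ≤ m 2ᶠ and f m ≤ q.
q^m≤m^[q+q] : ∀ q m → 2 ≤ m → m ≤ q → q ^ m ≤ m ^ (q + q)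
q^m≤m^[q+q] q m@(suc _) 2≤m m≤q = begin
  q ^ m                  ≤⟨ ^-monoˡ-≤ m q≤m2^f ⟩
  (m * 2 ^ f) ^ m        ≡⟨ ^-distribʳ-* m (2 ^ f) m ⟩
  m ^ m * (2 ^ f) ^ m    ≡⟨ cong (m ^ m *_) (^-*-assoc 2 f m) ⟩
  m ^ m * 2 ^ (f * m)    ≤⟨ *-mono-≤ (^-monoʳ-≤ m m≤q) (^-monoʳ-≤ 2 (m/n*n≤m q m)) ⟩
  m ^ q * 2 ^ q          ≤⟨ *-monoʳ-≤ (m ^ q) (^-monoˡ-≤ q 2≤m) ⟩
  m ^ q * m ^ q          ≡⟨ ^-distribˡ-+-* m q q ⟨
  m ^ (q + q)            ∎
  where
  open ≤-Reasoning
  f = q / m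
  q≤m2^f : q ≤ m * 2 ^ f
  q≤m2^f = begin
    q              ≡⟨ m≡m%n+[m/n]*n q m ⟩
    q % m + f * m  ≤⟨ +-monoˡ-≤ (f * m) (<⇒≤ (m%n<n q m)) ⟩
    suc f * m      ≡⟨ *-comm (suc f) m ⟩
    m * suc f      ≤⟨ *-monoʳ-≤ m (n<2^n f) ⟩
    m * 2 ^ f      ∎

least : ∀ {p} {P : ℕ → Set p} → Decidable P → ∀ n → P n →
        ∃ λ m → P m × m ≤ n × (∀ k → P k → m ≤ k)
least {P = P} P? = <-rec _ step
  where
  step : ∀ n → (∀ {m} → m < n → P m → ∃ λ l → P l × l ≤ m × (∀ k → P k → l ≤ k)) →
         P n → ∃ λ l → P l × l ≤ n × (∀ k → P k → l ≤ k)
  step n rec Pn with anyUpTo? P? n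
  ... | yes (m , m<n , Pm) = let l , Pl , l≤m , min = rec m<n Pm in
                             l , Pl , ≤-trans l≤m (<⇒≤ m<n) , min
  ... | no none = n , Pn , ≤-refl , λ k Pk → ≮⇒≥ λ k<n → none (k , k<n , Pk)

-- Periods and chains of borders

module Borders {m} {M : Set m} (_≟_ : DecidableEquality M) (Y : ℕ → M) where

  Period : ℕ → ℕ → Set m
  Period p s = ∀ x → x + p < s → Y (x + p) ≡ Y x

  period? : ∀ p s → Dec (Period p s)
  period? p s =
    map′ (λ h x x+p<s → h (≤-<-trans (m≤m+n x p) x+p<s) x+p<s) (λ h {x} _ → h x)
         (allUpTo? (λ x → (x + p <? s) →-dec (Y (x + p) ≟ Y x)) s)

  -- For `x < p` the comparison takes place within the prefix of length `t`, because
  -- `x + g < p + g ≤ t`. A larger `x` is first moved down by the period `p` on both sides of the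
  -- equation.
  extend-period : ∀ {p g s t} → 0 < p → Period p s → Period g t →
                  p + g ≤ t → t ≤ s → Period g s
  extend-period {p} {g} {s} {t} 0<p per-p per-g p+g≤t t≤s = <-rec _ step
    where
    step : ∀ x → (∀ {y} → y < x → y + g < s → Y (y + g) ≡ Y y) →
           x + g < s → Y (x + g) ≡ Y x
    step x rec x+g<s with x <? p
    ... | yes x<p = per-g x (<-≤-trans (+-monoˡ-< g x<p) p+g≤t)
    ... | no x≮p = begin
      Y (x + g)      ≡⟨ cong Y eq ⟩
      Y (y + g + p)  ≡⟨ per-p (y + g) (subst (_< s) eq x+g<s) ⟩
      Y (y + g)      ≡⟨ rec y<x (<-trans (+-monoˡ-< g y<x) x+g<s) ⟩
      Y y            ≡⟨ per-p y (subst (_< s) (sym y+p≡x) (≤-<-trans (m≤m+n x g) x+g<s)) ⟨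
      Y (y + p)      ≡⟨ cong Y y+p≡x ⟩
      Y x            ∎
      where
      open ≡-Reasoning
      y = x ∸ p
      y+p≡x : y + p ≡ x
      y+p≡x = m∸n+n≡m (≮⇒≥ x≮p)
      y<x : y < x
      y<x = subst (y <_) y+p≡x (m<m+n y 0<p)
      eq : x + g ≡ y + g + p
      eq = trans (cong (_+ g) (sym y+p≡x))
                 (trans (+-assoc y p g) (trans (cong (y +_) (+-comm p g)) (sym (+-assoc y g p))))

  -- Y[0..t) is a border of Y[0..s).
  _▷_ : Rel ℕ m
  s ▷ t = t < s × Period (s ∸ t) s

  -- The difference of two neighbours t < s with p ≤ t is a period of Y[0..s₀) too,
  -- hence at least p.
  long-borders : ∀ {p s₀} → 0 < p → Period p s₀ → (∀ g → 0 < g × Period g s₀ → p ≤ g) →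
    ∀ s ss → s ≤ s₀ → p ≤ s → AllPairs _▷_ (s ∷ ss) →
    ∃₂ λ xs ys → ss ≡ xs ++ ys × suc (length xs) * p ≤ s × All (_< p) ys × AllPairs _▷_ ys
  long-borders {p} 0<p per min s [] s≤s₀ p≤s _ =
    [] , [] , refl , subst (_≤ s) (sym (*-identityˡ p)) p≤s , [] , []
  long-borders {p} 0<p per min s (t ∷ ss) s≤s₀ p≤s (((t<s , per-s) ∷ _) ∷ chain@(t▷ ∷ _))
    with t <? p
  ... | yes t<p = [] , t ∷ ss , refl , subst (_≤ s) (sym (*-identityˡ p)) p≤s ,
                  (t<p ∷ All.map (λ t▷u → <-trans (proj₁ t▷u) t<p) t▷) , chain
  ... | no t≮p with long-borders 0<p per min t ss (≤-trans (<⇒≤ t<s) s≤s₀) (≮⇒≥ t≮p) chain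
  ...   | xs , ys , eq , xs≤ , short , chain′ =
    t ∷ xs , ys , cong (t ∷_) eq ,
    ≤-trans (+-mono-≤ p≤g xs≤) (≤-reflexive (m∸n+n≡m (<⇒≤ t<s))) ,
    short , chain′
    where
    g = s ∸ t
    p≤g : p ≤ g
    p≤g = min g (m<n⇒0<n∸m t<s ,
      extend-period 0<p per per-s
        (≤-trans (+-monoˡ-≤ g (≮⇒≥ t≮p)) (≤-reflexive (m+[n∸m]≡n (<⇒≤ t<s)))) s≤s₀)

  module _ {q} (2≤q : 2 ≤ q) where

    NoPower : ℕ → Set m
    NoPower s = ∀ p → 0 < p → Period p s → s < q * p

    -- The estimate `2q (1 + log_q s)` for the length of the chain, exponentiated with base `q`. The
    -- members of length at least the least period contribute the factor `q ^ m′`. The passage from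
    -- `s` to the first shorter member `t` makes up for it: some `c` has `q ^ m′ ≤ c ^ (q + q)` and
    -- `c * t ≤ s`.
    chain-bound : ∀ s ss → AllPairs _▷_ (s ∷ ss) → All (0 <_) (s ∷ ss) → All NoPower (s ∷ ss) →
                  q ^ length (s ∷ ss) ≤ (q * s) ^ (q + q)
    chain-bound = <-rec _ step
      where
      open ≤-Reasoning
      instance
        q≢0 : NonZero q
        q≢0 = >-nonZero (≤-trans (s≤s z≤n) 2≤q)
      step : ∀ s → (∀ {t} → t < s → ∀ ss → AllPairs _▷_ (t ∷ ss) → All (0 <_) (t ∷ ss) →
               All NoPower (t ∷ ss) → q ^ length (t ∷ ss) ≤ (q * t) ^ (q + q)) →
             ∀ ss → AllPairs _▷_ (s ∷ ss) → All (0 <_) (s ∷ ss) → All NoPower (s ∷ ss) →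
             q ^ length (s ∷ ss) ≤ (q * s) ^ (q + q)
      step s rec ss chain (0<s ∷ pos) (nopow ∷ nopows)
        -- The number `s` is vacuously a period of `Y[0..s)`, so the search for the least positive
        -- one succeeds.
        with least (λ p → (0 <? p) ×-dec period? p s) s
               (0<s , λ x x+s<s → contradiction (≤-<-trans (m≤n+m s x) x+s<s) (<-irrefl refl))
      ... | p , (0<p , per) , p≤s , min
        with long-borders 0<p per min s ss ≤-refl p≤s chain
      ...   | xs , ys , refl , xs≤s , short , chain′ = conclude ys refl
        where
        m′ = suc (length xs)
        m′<q : m′ < q
        m′<q = *-cancelʳ-< p m′ q (≤-<-trans xs≤s (nopow p 0<p per))
        pos′ = All.++⁻ʳ xs pos
        nopows′ = All.++⁻ʳ xs nopows

        few : ∀ xs t zs → All (s ▷_) (xs ++ t ∷ zs) → suc (length xs) < q → suc (length xs) * p ≤ s →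
              t < p → ∃ λ c → q ^ suc (length xs) ≤ c ^ (q + q) × c * t ≤ s
        -- If `s` is the only long member, then `s ∸ t` is a period and hence at least `p > t`, so
        -- `c = 2` will do.
        few [] t zs ((t<s , per-t) ∷ _) _ _ t<p = 2 , q≤ , 2t≤s
          where
          q≤ : q ^ 1 ≤ 2 ^ (q + q)
          q≤ = begin
            q ^ 1        ≡⟨ *-identityʳ q ⟩
            q            ≤⟨ <⇒≤ (n<2^n q) ⟩
            2 ^ q        ≤⟨ ^-monoʳ-≤ 2 (m≤m+n q q) ⟩
            2 ^ (q + q)  ∎
          2t≤s : 2 * t ≤ s
          2t≤s = begin
            t + (t + 0)   ≡⟨ cong (t +_) (+-identityʳ t) ⟩
            t + t         ≤⟨ +-monoˡ-≤ t (≤-trans (<⇒≤ t<p) (min (s ∸ t) (m<n⇒0<n∸m t<s , per-t))) ⟩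
            s ∸ t + t     ≡⟨ m∸n+n≡m (<⇒≤ t<s) ⟩
            s             ∎
        -- Otherwise `c` is the number of long members, which is at least 2.
        few xs@(_ ∷ _) t zs _ m<q mp≤s t<p =
          suc (length xs) , q^m≤m^[q+q] q _ (s≤s (s≤s z≤n)) (<⇒≤ m<q) ,
          ≤-trans (*-monoʳ-≤ (suc (length xs)) (<⇒≤ t<p)) mp≤s

        conclude : ∀ zs → ys ≡ zs → q ^ length (s ∷ xs ++ ys) ≤ (q * s) ^ (q + q)
        conclude [] refl = begin
          q ^ length (s ∷ xs ++ [])  ≡⟨ cong (λ l → q ^ length (s ∷ l)) (++-identityʳ xs) ⟩
          q ^ m′                     ≤⟨ ^-monoʳ-≤ q (≤-trans (<⇒≤ m′<q) (m≤m+n q q)) ⟩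
          q ^ (q + q)                ≤⟨ ^-monoˡ-≤ (q + q) (m≤m*n q s {{>-nonZero 0<s}}) ⟩
          (q * s) ^ (q + q)          ∎
        conclude (t ∷ zs) refl
          with few xs t zs (AllPairs.head chain) m′<q xs≤s (All.head short)
        ... | c , q^m≤ , ct≤s = begin
          q ^ length (s ∷ xs ++ t ∷ zs)            ≡⟨ cong (q ^_) (length-++ (s ∷ xs)) ⟩
          q ^ (m′ + length (t ∷ zs))               ≡⟨ ^-distribˡ-+-* q m′ _ ⟩
          q ^ m′ * q ^ length (t ∷ zs)             ≤⟨ *-mono-≤ q^m≤ (rec t<s zs chain′ pos′ nopows′) ⟩
          c ^ (q + q) * (q * t) ^ (q + q)          ≡⟨ ^-distribʳ-* c (q * t) (q + q) ⟨
          (c * (q * t)) ^ (q + q)                  ≤⟨ ^-monoˡ-≤ (q + q) cqt≤ ⟩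
          (q * s) ^ (q + q)                        ∎
          where
          t<s : t < s
          t<s = <-≤-trans (All.head short) p≤s
          cqt≤ : c * (q * t) ≤ q * s
          cqt≤ = begin
            c * (q * t)  ≡⟨ *-assoc c q t ⟨
            c * q * t    ≡⟨ cong (_* t) (*-comm c q) ⟩
            q * c * t    ≡⟨ *-assoc q c t ⟩
            q * (c * t)  ≤⟨ *-monoʳ-≤ q ct≤s ⟩
            q * s        ∎

-- Counting

AllPairs-map-All : {P : Pred X p} {R : Rel X r} {S : Rel X s} →
  (∀ {x y} → P x → P y → R x y → S x y) →
  ∀ {xs} → All P xs → AllPairs R xs → AllPairs S xs
AllPairs-map-All h []         []         = []
AllPairs-map-All h (px ∷ pxs) (rx ∷ rxs) =
  All.zipWith (λ (py , rxy) → h px py rxy) (pxs , rx) ∷ AllPairs-map-All h pxs rxs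

module _ {P : Pred X p} {_≈_ : Rel X r} (B : ℕ → Set) where

  -- `image` takes the membership proof as an argument, because it will be a witness extracted from
  -- that proof. By `reflects`, inequivalent elements have inequivalent images, so `numQ` applies to
  -- a list of the same length.
  number-via : {Q : Pred Y s} {_≈′_ : Rel Y t} (image : ∀ {x} → P x → Y) →
    (∀ {x} (px : P x) → Q (image px)) →
    (∀ {x x′} (px : P x) (px′ : P x′) → image px ≈′ image px′ → x ≈ x′) →
    Number Q _≈′_ B → Number P _≈_ B
  number-via {Q = Q} {_≈′_} image image-Q reflects numQ xs Pxs distinct =
    subst B (lengths Pxs) (numQ (All.reduce image Pxs) (all-Q Pxs) (pairs Pxs distinct))
    where
    lengths : ∀ {xs} (Pxs : All P xs) → length (All.reduce image Pxs) ≡ length xs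
    lengths []        = refl
    lengths (_ ∷ Pxs) = cong suc (lengths Pxs)
    all-Q : ∀ {xs} (Pxs : All P xs) → All Q (All.reduce image Pxs)
    all-Q []         = []
    all-Q (px ∷ Pxs) = image-Q px ∷ all-Q Pxs
    apart : ∀ {x xs} (px : P x) (Pxs : All P xs) → All (λ x′ → ¬ (x ≈ x′)) xs →
            All (λ y′ → ¬ (image px ≈′ y′)) (All.reduce image Pxs)
    apart px []          []         = []
    apart px (px′ ∷ Pxs) (x≉ ∷ x≉s) = (x≉ ∘ reflects px px′) ∷ apart px Pxs x≉s
    pairs : ∀ {xs} (Pxs : All P xs) → AllPairs (λ x x′ → ¬ (x ≈ x′)) xs →
            AllPairs (λ y y′ → ¬ (y ≈′ y′)) (All.reduce image Pxs)
    pairs []         []           = []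
    pairs (px ∷ Pxs) (x≉s ∷ dist) = apart px Pxs x≉s ∷ pairs Pxs dist

  number-⊆ : {Q : Pred X s} → (∀ {x} → P x → Q x) → Number Q _≈_ B → Number P _≈_ B
  number-⊆ P⊆Q numQ xs Pxs = numQ xs (All.map P⊆Q Pxs)

  number-≤1 : (∀ {x y} → P x → P y → x ≈ y) → B 0 → B 1 → Number P _≈_ B
  number-≤1 unique b₀ b₁ []           _              _                = b₀
  number-≤1 unique b₀ b₁ (x ∷ [])     _              _                = b₁
  number-≤1 unique b₀ b₁ (x ∷ y ∷ xs) (px ∷ py ∷ _) ((x≉y ∷ _) ∷ _) =
    contradiction (unique px py) x≉y

module _ {P : Pred X p} {_≈_ : Rel X r} (q : ℕ) where

  -- Bounds on `N` are carried as bounds on `q ^ N`, so where the counts add, the bounds multiply.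
  number-split : ∀ b c {R : Pred X s} → Decidable R →
    Number (λ x → P x × R x) _≈_ (λ n → q ^ n ≤ b) →
    Number (λ x → P x × ¬ R x) _≈_ (λ n → q ^ n ≤ c) →
    Number P _≈_ (λ n → q ^ n ≤ b * c)
  number-split b c R? numR num¬R xs Pxs distinct = begin
    q ^ length xs                     ≡⟨ cong (q ^_) (halves xs) ⟨
    q ^ (length rs + length ns)       ≡⟨ ^-distribˡ-+-* q (length rs) _ ⟩
    q ^ length rs * q ^ length ns     ≤⟨ *-mono-≤
      (numR rs (All.zip (All.filter⁺ R? Pxs , All.all-filter R? xs)) (AllPairs.filter⁺ R? distinct))
      (num¬R ns (All.zip (All.filter⁺ (¬? ∘ R?) Pxs , All.all-filter (¬? ∘ R?) xs))
        (AllPairs.filter⁺ (¬? ∘ R?) distinct)) ⟩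
    b * c                             ∎
    where
    open ≤-Reasoning
    rs = filter R? xs
    ns = filter (¬? ∘ R?) xs
    halves : ∀ xs → length (filter R? xs) + length (filter (¬? ∘ R?) xs) ≡ length xs
    halves []       = refl
    halves (x ∷ xs) with R? x
    ... | yes _ = cong suc (halves xs)
    ... | no  _ = trans (+-suc _ _) (cong suc (halves xs))

module _ {P : Pred X p} {_≈_ : Rel X r} (q : ℕ) where

  number-keys : ∀ {b} {K : Set s} → DecidableEquality K → (key : X → K) →
    (∀ k → Number (λ x → P x × key x ≡ k) _≈_ (λ n → q ^ n ≤ b)) →
    ∀ ks → (∀ {x} → P x → key x ∈ ks) → Number P _≈_ (λ n → q ^ n ≤ b ^ length ks)
  number-keys {b = b} _≟_ key bound ks P⇒∈ =
    number-⊆ (λ n → q ^ n ≤ b ^ length ks) (λ px → px , P⇒∈ px) (go ks)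
    where
    go : ∀ ks → Number (λ x → P x × key x ∈ ks) _≈_ (λ n → q ^ n ≤ b ^ length ks)
    go []       []      _              _ = ≤-refl
    go []       (_ ∷ _) ((_ , ()) ∷ _)
    go (k ∷ ks) = number-split q b (b ^ length ks) (λ x → key x ≟ k)
      (number-⊆ (λ n → q ^ n ≤ b) (λ ((px , _) , key≡) → px , key≡) (bound k))
      (number-⊆ (λ n → q ^ n ≤ b ^ length ks)
        (λ { ((px , here key≡) , key≢) → contradiction key≡ key≢
           ; ((px , there key∈) , _) → px , key∈ }) (go ks))

length-cartesianProduct : (xs : List X) (ys : List Y) →
                          length (cartesianProduct xs ys) ≡ length xs * length ys
length-cartesianProduct []       ys = refl
length-cartesianProduct (x ∷ xs) ys =
  trans (length-++ (map (x ,_) ys)) (cong₂ _+_ (length-map (x ,_) ys) (length-cartesianProduct xs ys))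

-- Pairs of occurrences straddling two gaps

module Pairs {m} {M : Set m} (_≟_ : DecidableEquality M) (f : ℕ → M) (n q : ℕ) (G : List ℕ)
  (0<n : 0 < n) (2≤q : 2 ≤ q)
  -- `f` stands for `$S$` with the delimiters at 0 and `suc n`; the bounds keep the stretch of
  -- length `q * p` within the positions 1 to `n`.
  (no-power : ∀ c p → 0 < c → 0 < p → c + q * p ≤ suc n →
     ¬ (∀ x → x + p < q * p → f (c + (x + p)) ≡ f (c + x))) where

  private
    B = (q * n) ^ (q + q)

    instance
      q≢0 : NonZero q
      q≢0 = >-nonZero (≤-trans (s≤s z≤n) 2≤q)
      n≢0 : NonZero n
      n≢0 = >-nonZero 0<n
      qn≢0 : NonZero (q * n)
      qn≢0 = m*n≢0 q n

    1≤B : 1 ≤ B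
    1≤B = m^n>0 (q * n) (q + q)

    q≤B : q ≤ B
    q≤B = begin
      q                ≤⟨ m≤m*n q n ⟩
      q * n            ≡⟨ ^-identityʳ (q * n) ⟨
      (q * n) ^ 1      ≤⟨ ^-monoʳ-≤ (q * n) (≤-trans (≤-trans (s≤s z≤n) 2≤q) (m≤m+n q q)) ⟩
      B                ∎
      where open ≤-Reasoning

  -- `t` is the difference of `h` and `s`, given by an equation to avoid truncated subtraction. The
  -- bound on `h′ + s` keeps the second copy clear of the closing delimiter.
  Shift : ℕ → ℕ → ℕ → Set m
  Shift h h′ s = 0 < s × s ≤ n × h′ + s ≤ suc n ×
                 ∃ λ t → h ≡ t + s × (∀ r → r < s → f (t + r) ≡ f (h′ + r))

  -- f[h-s..h) = f[h′..h′+s) for every shift s, so the shorter ones are borders of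
  -- the longer ones.
  number-shifts : ∀ h h′ → 0 < h′ → Number (Shift h h′) _≡_ (λ N → q ^ N ≤ B)
  number-shifts h h′ 0<h′ ss shifts distinct =
    subst (λ N → q ^ N ≤ B) (↭-length (sort-↭ ss)) (bound (sort ss) shifts′ chain)
    where
    open Borders _≟_ (λ r → f (h′ + r))

    shifts′ : All (Shift h h′) (sort ss)
    shifts′ = All-resp-↭ (↭-sym (sort-↭ ss)) shifts

    -- The copies before `h` end at the same place, so the shorter one starts `g` later. Thus
    -- position `x + g` of the longer string is position `x` of the shorter one, and this yields the
    -- period `g`.
    border : ∀ {s₁ s₂} → Shift h h′ s₁ → Shift h h′ s₂ → s₂ ≤ s₁ × s₁ ≢ s₂ → s₁ ▷ s₂
    border {s₁} {s₂} (_ , _ , _ , t₁ , h≡₁ , match₁) (_ , _ , _ , t₂ , h≡₂ , match₂) (s₂≤s₁ , s₁≢s₂) =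
      ≤∧≢⇒< s₂≤s₁ (s₁≢s₂ ∘ sym) , per
      where
      g = s₁ ∸ s₂
      g+s₂≡s₁ : g + s₂ ≡ s₁
      g+s₂≡s₁ = m∸n+n≡m s₂≤s₁
      t₁+g≡t₂ : t₁ + g ≡ t₂
      t₁+g≡t₂ = +-cancelʳ-≡ s₂ (t₁ + g) t₂
        (trans (+-assoc t₁ g s₂) (trans (cong (t₁ +_) g+s₂≡s₁) (trans (sym h≡₁) h≡₂)))
      per : Period g s₁
      per x x+g<s₁ = begin
        f (h′ + (x + g))   ≡⟨ match₁ (x + g) x+g<s₁ ⟨
        f (t₁ + (x + g))   ≡⟨ cong f (trans (cong (t₁ +_) (+-comm x g)) (sym (+-assoc t₁ g x))) ⟩
        f (t₁ + g + x)     ≡⟨ cong (λ t → f (t + x)) t₁+g≡t₂ ⟩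
        f (t₂ + x)         ≡⟨ match₂ x (+-cancelʳ-< g x s₂
                                (subst (x + g <_) (trans (sym g+s₂≡s₁) (+-comm g s₂)) x+g<s₁)) ⟩
        f (h′ + x)         ∎
        where open ≡-Reasoning

    -- `sort` uses the flipped order, so the longest shift comes first, as `▷` requires.
    chain : AllPairs _▷_ (sort ss)
    chain = AllPairs-map-All border shifts′
      (AllPairs.zip (Linked⇒AllPairs (λ i≥j j≥k → ≤-trans j≥k i≥j) (sort-↗ ss) ,
                     Unique-resp-↭ (↭⇒↭ₛ (↭-sym (sort-↭ ss))) distinct))

    no-powers : ∀ {s} → Shift h h′ s → NoPower 2≤q s
    no-powers (_ , _ , h′+s≤ , _) p 0<p per = ≰⇒> λ qp≤s →
      no-power h′ p 0<h′ 0<p (≤-trans (+-monoʳ-≤ h′ qp≤s) h′+s≤) λ x x+p<qp → per x (<-≤-trans x+p<qp qp≤s)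

    bound : ∀ ss → All (Shift h h′) ss → AllPairs _▷_ ss → q ^ length ss ≤ B
    bound []       _                                chain = 1≤B
    bound (s ∷ ss) shifts@((_ , s≤n , _) ∷ _) chain =
      ≤-trans (chain-bound 2≤q s ss chain (All.map proj₁ shifts) (All.map no-powers shifts))
              (^-monoˡ-≤ (q + q) (*-monoʳ-≤ q s≤n))

  -- x P a and y P b start at positions k and k′ of f, P has length len, and the
  -- occurrences of P have u and u′ characters before the gaps that are straddled.
  record Pair : Set m where
    field
      k k′ len u u′ : ℕ
      u≤len    : u ≤ len
      u′≤len   : u′ ≤ len
      gap∈     : suc (k + u) ∈ G
      gap′∈    : suc (k′ + u′) ∈ G
      mismatch : f k ≢ f k′
      match    : ∀ r → r < len → f (suc (k + r)) ≡ f (suc (k′ + r))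
      mismatchʳ : f (suc (k + len)) ≢ f (suc (k′ + len))
      bounded  : k + len ≤ n
      bounded′ : k′ + len ≤ n

    gap gap′ : ℕ
    gap  = suc (k + u)
    gap′ = suc (k′ + u′)

  open Pair

  infix 4 _≋_

  -- Symmetric in the two occurrences, so that `swap-pair` respects it.
  _≋_ : Rel Pair _
  π ≋ ρ = k π ≡ k ρ × k′ π ≡ k′ ρ × len π ≡ len ρ

  swap-pair : Pair → Pair
  swap-pair π = record
    { k = k′ π ; k′ = k π ; len = len π ; u = u′ π ; u′ = u π
    ; u≤len = u′≤len π ; u′≤len = u≤len π ; gap∈ = gap′∈ π ; gap′∈ = gap∈ π
    ; mismatch = mismatch π ∘ sym ; match = λ r r< → sym (match π r r<)
    ; mismatchʳ = mismatchʳ π ∘ sym ; bounded = bounded′ π ; bounded′ = bounded π }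

  private
    -- The left mismatch of π would lie inside P in ρ.
    not-left : ∀ π ρ {v w} → v < w → w ≤ len ρ → k π + v ≡ k ρ + w → k′ π + v ≡ k′ ρ + w → ⊥
    not-left π ρ {v} {w} v<w w≤len eq eq′ = mismatch π (begin
      f (k π)             ≡⟨ cong f (inside (k π) (k ρ) eq) ⟩
      f (suc (k ρ + e))   ≡⟨ match ρ e (≤-trans e<w w≤len) ⟩
      f (suc (k′ ρ + e))  ≡⟨ cong f (inside (k′ π) (k′ ρ) eq′) ⟨
      f (k′ π)            ∎)
      where
      open ≡-Reasoning
      e = w ∸ suc v
      sucv+e≡w : suc v + e ≡ w
      sucv+e≡w = m+[n∸m]≡n v<w
      e<w : e < w
      e<w = subst (e <_) sucv+e≡w (s≤s (m≤n+m e v))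
      inside : ∀ i j → i + v ≡ j + w → i ≡ suc (j + e)
      inside i j i+v≡j+w = +-cancelʳ-≡ v i (suc (j + e)) (begin
        i + v              ≡⟨ i+v≡j+w ⟩
        j + w              ≡⟨ cong (j +_) sucv+e≡w ⟨
        j + (suc v + e)    ≡⟨ cong (j +_) (+-comm (suc v) e) ⟩
        j + (e + suc v)    ≡⟨ +-assoc j e (suc v) ⟨
        j + e + suc v      ≡⟨ +-suc (j + e) v ⟩
        suc (j + e) + v    ∎)

    -- The right mismatch of `π` would lie inside `P` in `ρ`.
    not-longer : ∀ π ρ → k π ≡ k ρ → k′ π ≡ k′ ρ → ¬ (len π < len ρ)
    not-longer π ρ refl refl shorter = mismatchʳ π (match ρ (len π) shorter)

    -- `k + u′` and `k′ + u′` mark corresponding places in the two occurrences. The matching stretch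
    -- around these places is cut off by mismatches at both ends, so the places determine the pair:
    -- `not-left` fixes its left end and `not-longer` its length.
    same : ∀ π ρ → k π + u′ π ≡ k ρ + u′ ρ → k′ π + u′ π ≡ k′ ρ + u′ ρ → π ≋ ρ
    same π ρ eq eq′ with <-cmp (u′ π) (u′ ρ)
    ... | tri< u′< _ _ = contradiction (u′≤len ρ) λ u′≤ → not-left π ρ u′< u′≤ eq eq′
    ... | tri> _ _ u′> = contradiction (u′≤len π) λ u′≤ → not-left ρ π u′> u′≤ (sym eq) (sym eq′)
    ... | tri≈ _ u′≡ _ = k≡ , k′≡ , ≤-antisym (≮⇒≥ (not-longer ρ π (sym k≡) (sym k′≡)))
                                              (≮⇒≥ (not-longer π ρ k≡ k′≡))
      where
      k≡ = +-cancelʳ-≡ (u′ π) (k π) (k ρ) (trans eq (cong (k ρ +_) (sym u′≡)))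
      k′≡ = +-cancelʳ-≡ (u′ π) (k′ π) (k′ ρ) (trans eq′ (cong (k′ ρ +_) (sym u′≡)))

    At : ℕ → ℕ → Pair → Set
    At h h′ π = h ≡ gap π × h′ ≡ gap′ π

    -- The characters of `P` from offset `u′` up to `u` end right before `h` in the first occurrence
    -- and start at `h′` in the second, so `u ∸ u′` is a shift. Together with the gaps it gives the
    -- alignment that `same` asks for.
    number-rightward : ∀ h h′ → Number (λ π → At h h′ π × u′ π < u π) _≋_ (λ N → q ^ N ≤ B)
    number-rightward h zero    []      _                   _ = 1≤B
    number-rightward h zero    (_ ∷ _) (((_ , ()) , _) ∷ _)
    number-rightward h h′@(suc _) =
      number-via (λ N → q ^ N ≤ B) (λ {π} _ → u π ∸ u′ π) (λ {π} → shift π) (λ {π} {ρ} → reflects π ρ)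
        (number-shifts h h′ (s≤s z≤n))
      where
      split-u : ∀ π → u′ π < u π → u′ π + (u π ∸ u′ π) ≡ u π
      split-u π u′<u = m+[n∸m]≡n (<⇒≤ u′<u)
      k+u : ∀ π (u′<u : u′ π < u π) → k π + u π ≡ k π + u′ π + (u π ∸ u′ π)
      k+u π u′<u = trans (cong (k π +_) (sym (split-u π u′<u))) (sym (+-assoc (k π) (u′ π) _))
      shift : ∀ π → At h h′ π × u′ π < u π → Shift h h′ (u π ∸ u′ π)
      shift π ((refl , refl) , u′<u) =
        m<n⇒0<n∸m u′<u ,
        ≤-trans (m∸n≤m (u π) (u′ π)) (≤-trans (u≤len π) (≤-trans (m≤n+m (len π) (k π)) (bounded π))) ,
        s≤s (≤-trans (≤-reflexive (trans (+-assoc (k′ π) (u′ π) _) (cong (k′ π +_) (split-u π u′<u))))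
               (≤-trans (+-monoʳ-≤ (k′ π) (u≤len π)) (bounded′ π))) ,
        suc (k π + u′ π) , cong suc (k+u π u′<u) ,
        λ r r<s → begin
          f (suc (k π + u′ π + r))     ≡⟨ cong (f ∘ suc) (+-assoc (k π) (u′ π) r) ⟩
          f (suc (k π + (u′ π + r)))   ≡⟨ match π (u′ π + r)
            (<-≤-trans (subst (u′ π + r <_) (split-u π u′<u) (+-monoʳ-< (u′ π) r<s)) (u≤len π)) ⟩
          f (suc (k′ π + (u′ π + r)))  ≡⟨ cong (f ∘ suc) (+-assoc (k′ π) (u′ π) r) ⟨
          f (suc (k′ π + u′ π + r))    ∎
        where open ≡-Reasoning
      reflects : ∀ π ρ → At h h′ π × u′ π < u π → At h h′ ρ × u′ ρ < u ρ →
                 u π ∸ u′ π ≡ u ρ ∸ u′ ρ → π ≋ ρ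
      reflects π ρ ((h≡ , h′≡) , u′<u) ((h≡₂ , h′≡₂) , u′<u₂) shift≡ =
        same π ρ (+-cancelʳ-≡ (u π ∸ u′ π) _ _ (begin
          k π + u′ π + (u π ∸ u′ π)  ≡⟨ k+u π u′<u ⟨
          k π + u π                  ≡⟨ suc-injective (trans (sym h≡) h≡₂) ⟩
          k ρ + u ρ                  ≡⟨ k+u ρ u′<u₂ ⟩
          k ρ + u′ ρ + (u ρ ∸ u′ ρ)  ≡⟨ cong (k ρ + u′ ρ +_) shift≡ ⟨
          k ρ + u′ ρ + (u π ∸ u′ π)  ∎))
          (suc-injective (trans (sym h′≡) h′≡₂))
        where open ≡-Reasoning

    -- There is one factor `B` for each of the cases `u′ < u`, `u < u′` and `u ≡ u′`. The second is
    -- the first with the occurrences exchanged. In the third the gaps alone fix the alignment, so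
    -- there is at most one pair.
    number-at : ∀ h h′ → Number (At h h′) _≋_ (λ N → q ^ N ≤ B * (B * B))
    number-at h h′ = number-split q B (B * B) (λ π → u′ π <? u π) (number-rightward h h′)
      (number-split q B B (λ π → u π <? u′ π)
        (number-via bounded-by-B (λ {π} _ → swap-pair π) (λ (((h≡ , h′≡) , _) , u<u′) → (h′≡ , h≡) , u<u′)
          (λ _ _ (k′≡ , k≡ , len≡) → k≡ , k′≡ , len≡) (number-rightward h′ h))
        (number-≤1 bounded-by-B
          (λ {π} {ρ} (((h≡ , h′≡) , u′≮u) , u≮u′) (((h≡₂ , h′≡₂) , u′≮u₂) , u≮u′₂) →
            same π ρ (trans (cong (k π +_) (≤-antisym (≮⇒≥ u≮u′) (≮⇒≥ u′≮u)))
                       (trans (suc-injective (trans (sym h≡) h≡₂))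
                         (cong (k ρ +_) (≤-antisym (≮⇒≥ u′≮u₂) (≮⇒≥ u≮u′₂)))))
                     (suc-injective (trans (sym h′≡) h′≡₂)))
          1≤B (subst (_≤ B) (sym (*-identityʳ q)) q≤B)))
      where
      bounded-by-B = λ N → q ^ N ≤ B

  number-pairs : Number (λ (_ : Pair) → ⊤) _≋_ (λ N → q ^ N ≤ (B * (B * B)) ^ (length G * length G))
  number-pairs = subst (λ e → Number (λ _ → ⊤) _≋_ (λ N → q ^ N ≤ (B * (B * B)) ^ e))
    (length-cartesianProduct G G)
    (number-keys q (≡-dec _≟ℕ_ _≟ℕ_) (λ π → gap π , gap′ π)
      (λ (h , h′) → number-⊆ (λ N → q ^ N ≤ B * (B * B)) (λ { (_ , refl) → refl , refl }) (number-at h h′))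
      (cartesianProduct G G) (λ {π} _ → ∈-cartesianProduct⁺ (gap∈ π) (gap′∈ π)))

-- Positions in strings

infixl 9 _‼_

_‼_ : List X → ℕ → Maybe X
[]       ‼ _     = nothing
(x ∷ xs) ‼ zero  = just x
(x ∷ xs) ‼ suc i = xs ‼ i

‼-just⇒< : ∀ (xs : List X) i {x} → xs ‼ i ≡ just x → i < length xs
‼-just⇒< (x ∷ xs) zero    _  = s≤s z≤n
‼-just⇒< (x ∷ xs) (suc i) eq = s≤s (‼-just⇒< xs i eq)

<⇒‼-just : ∀ (xs : List X) i → i < length xs → ∃ λ x → xs ‼ i ≡ just x
<⇒‼-just (x ∷ xs) zero    _         = x , refl
<⇒‼-just (x ∷ xs) (suc i) (s≤s i<n) = <⇒‼-just xs i i<n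

‼-++ˡ : ∀ (xs ys : List X) i → i < length xs → (xs ++ ys) ‼ i ≡ xs ‼ i
‼-++ˡ (x ∷ xs) ys zero    _         = refl
‼-++ˡ (x ∷ xs) ys (suc i) (s≤s i<n) = ‼-++ˡ xs ys i i<n

‼-++ʳ : ∀ (xs ys : List X) i → (xs ++ ys) ‼ (length xs + i) ≡ ys ‼ i
‼-++ʳ []       ys i = refl
‼-++ʳ (x ∷ xs) ys i = ‼-++ʳ xs ys i

‼-ext : ∀ (xs ys : List X) → length xs ≡ length ys → (∀ r → r < length xs → xs ‼ r ≡ ys ‼ r) → xs ≡ ys
‼-ext []       []       _ _ = refl
‼-ext (x ∷ xs) (y ∷ ys) l h =
  cong₂ _∷_ (just-injective (h 0 (s≤s z≤n))) (‼-ext xs ys (suc-injective l) λ r r< → h (suc r) (s≤s r<))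

-- As `W ‼ r` is a `just` for `r < length W`, the equations also keep the occurrence within `T`. The
-- empty string occurs at every number.
Occ : List X → List X → ℕ → Set _
Occ T W c = ∀ r → r < length W → T ‼ (c + r) ≡ W ‼ r

Occ-++⁺ : ∀ (T V W : List X) c → Occ T V c → Occ T W (c + length V) → Occ T (V ++ W) c
Occ-++⁺ T []      W c _    occW r r< rewrite +-identityʳ c = occW r r<
Occ-++⁺ T (v ∷ V) W c occV occW zero    _        = occV 0 (s≤s z≤n)
Occ-++⁺ T (v ∷ V) W c occV occW (suc r) (s≤s r<) =
  trans (cong (T ‼_) (+-suc c r))
    (Occ-++⁺ T V W (suc c) (λ r r< → trans (cong (T ‼_) (sym (+-suc c r))) (occV (suc r) (s≤s r<)))
      (subst (Occ T W) (+-suc c (length V)) occW) r r<)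

Occ-++⁻ˡ : ∀ (T V W : List X) c → Occ T (V ++ W) c → Occ T V c
Occ-++⁻ˡ T V W c occ r r< =
  trans (occ r (<-≤-trans r< (≤-trans (m≤m+n _ _) (≤-reflexive (sym (length-++ V))))))
        (‼-++ˡ V W r r<)

Occ-++⁻ʳ : ∀ (T V W : List X) c → Occ T (V ++ W) c → Occ T W (c + length V)
Occ-++⁻ʳ T V W c occ r r< = begin
  T ‼ (c + length V + r)    ≡⟨ cong (T ‼_) (+-assoc c (length V) r) ⟩
  T ‼ (c + (length V + r))  ≡⟨ occ (length V + r) (subst (length V + r <_) (sym (length-++ V))
                                  (+-monoʳ-< (length V) r<)) ⟩
  (V ++ W) ‼ (length V + r) ≡⟨ ‼-++ʳ V W r ⟩
  W ‼ r                     ∎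
  where open ≡-Reasoning

Occ-∷ʳ : ∀ (T V : List X) x c → Occ T (V ∷ʳ x) c → T ‼ (c + length V) ≡ just x
Occ-∷ʳ T V x c occ =
  trans (cong (T ‼_) (sym (+-identityʳ (c + length V)))) (Occ-++⁻ʳ T V [ x ] c occ 0 (s≤s z≤n))

Occ-[] : ∀ (T : List X) x c → T ‼ c ≡ just x → Occ T [ x ] c
Occ-[] T x c eq zero    _        = trans (cong (T ‼_) (+-identityʳ c)) eq
Occ-[] T x c eq (suc r) (s≤s ())

Occ-bounded : ∀ (T W : List X) c → W ≢ [] → Occ T W c → c + length W ≤ length T
Occ-bounded T []      c W≢[] occ = contradiction refl W≢[]
Occ-bounded T (w ∷ W) c W≢[] occ =
  let _ , eq = <⇒‼-just (w ∷ W) (length W) ≤-refl in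
  subst (_≤ length T) (sym (+-suc c (length W))) (‼-just⇒< T _ (trans (occ (length W) ≤-refl) eq))

prefix⇒Occ : ∀ {T W : List X} → Prefix _≡_ W T → Occ T W 0
prefix⇒Occ (refl ∷ p) zero    _        = refl
prefix⇒Occ (refl ∷ p) (suc r) (s≤s r<) = prefix⇒Occ p r r<

Occ⇒prefix : ∀ (T W : List X) → Occ T W 0 → Prefix _≡_ W T
Occ⇒prefix T       []      occ = []
Occ⇒prefix []      (w ∷ W) occ with () ← occ 0 (s≤s z≤n)
Occ⇒prefix (t ∷ T) (w ∷ W) occ =
  just-injective (sym (occ 0 (s≤s z≤n))) ∷ Occ⇒prefix T W λ r r< → occ (suc r) (s≤s r<)

infix⇒Occ : ∀ {T W : List X} → Infix _≡_ W T → ∃ λ c → c ≤ length T × Occ T W c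
infix⇒Occ (here p) = 0 , z≤n , prefix⇒Occ p
infix⇒Occ (there i) = let c , c≤ , occ = infix⇒Occ i in suc c , s≤s c≤ , occ

Occ⇒infix : ∀ (T W : List X) c → c ≤ length T → Occ T W c → Infix _≡_ W T
Occ⇒infix T       W zero    _         occ = here (Occ⇒prefix T W occ)
Occ⇒infix (t ∷ T) W (suc c) (s≤s c≤n) occ = there (Occ⇒infix T W c c≤n occ)

suffix⇒Occ : ∀ {T W : List X} → Suffix _≡_ W T → ∃ λ c → Occ T W c × c + length W ≡ length T
suffix⇒Occ (here p) with refl ← Pointwise-≡⇒≡ p = 0 , (λ r r< → refl) , refl
suffix⇒Occ (there s) = let c , occ , eq = suffix⇒Occ s in suc c , occ , cong suc eq

Occ⇒suffix : ∀ (T W : List X) c → Occ T W c → c + length W ≡ length T → Suffix _≡_ W T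
Occ⇒suffix T       W zero    occ eq = here (≡⇒Pointwise-≡ (sym (‼-ext T W (sym eq) λ r r< → occ r (subst (r <_) (sym eq) r<))))
Occ⇒suffix (t ∷ T) W (suc c) occ eq = there (Occ⇒suffix T W c occ (suc-injective eq))

slice : ∀ (T : List X) c p → c + p ≤ length T →
        length (take p (drop c T)) ≡ p × Occ T (take p (drop c T)) c
slice T       zero    zero    _         = refl , λ r ()
slice (t ∷ T) zero    (suc p) (s≤s p≤n) =
  cong suc (proj₁ (slice T 0 p p≤n)) ,
  λ { zero _ → refl ; (suc r) (s≤s r<) → proj₂ (slice T 0 p p≤n) r r< }
slice (t ∷ T) (suc c) p (s≤s c+p≤n) = slice T c p c+p≤n

Occ-^ʷ : ∀ (T w : List X) m c → (∀ j → j < m → Occ T w (c + j * length w)) → Occ T (w ^ʷ m) c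
Occ-^ʷ T w zero    c occ r ()
Occ-^ʷ T w (suc m) c occ = Occ-++⁺ T w (w ^ʷ m) c
  (subst (Occ T w) (+-identityʳ c) (occ 0 (s≤s z≤n)))
  (Occ-^ʷ T w m (c + length w) λ j j<m →
    subst (Occ T w) (sym (+-assoc c (length w) _)) (occ (suc j) (s≤s j<m)))

-- A stretch of length `q * p` with period `p` is the `q`-th power of its first `p` characters; the
-- period carries each copy to the next.
^ʷ-period-free : ∀ (T : List X) q → 0 < q → PowerFree q T → ∀ c p → 0 < p → c + q * p ≤ length T →
                 ¬ (∀ x → x + p < q * p → T ‼ (c + (x + p)) ≡ T ‼ (c + x))
^ʷ-period-free T q@(suc q-1) _ free c p@(suc _) _ c+qp≤n per =
  free w (λ w≡[] → contradiction (trans (sym |w|≡p) (cong length w≡[])) λ ())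
    (Occ⇒infix T (w ^ʷ q) c (m+n≤o⇒m≤o c c+qp≤n) (Occ-^ʷ T w q c λ j j<q → occ-w j j<q))
  where
  w = take p (drop c T)
  c+p≤n : c + p ≤ length T
  c+p≤n = ≤-trans (+-monoʳ-≤ c (m≤m+n p (q-1 * p))) c+qp≤n
  |w|≡p = proj₁ (slice T c p c+p≤n)
  occ-w : ∀ j → j < q → Occ T w (c + j * length w)
  occ-w zero    _    = subst (Occ T w) (sym (+-identityʳ c)) (proj₂ (slice T c p c+p≤n))
  occ-w (suc j) j<q r r< = begin
    T ‼ (c + suc j * length w + r)     ≡⟨ cong (T ‼_) (trans (+-assoc c _ r) (cong (c +_) shuffle)) ⟩
    T ‼ (c + (j * length w + r + p))   ≡⟨ per (j * length w + r) in-range ⟩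
    T ‼ (c + (j * length w + r))       ≡⟨ cong (T ‼_) (+-assoc c _ r) ⟨
    T ‼ (c + j * length w + r)         ≡⟨ occ-w j (<-trans ≤-refl j<q) r r< ⟩
    w ‼ r                              ∎
    where
    shuffle : suc j * length w + r ≡ j * length w + r + p
    shuffle = trans (+-assoc (length w) _ r) (trans (+-comm (length w) _) (cong (j * length w + r +_) |w|≡p))
    in-range : j * length w + r + p < q * p
    in-range = subst (_< q * p) shuffle
      (<-≤-trans (+-monoʳ-< (suc j * length w) r<)
        (≤-trans (≤-reflexive (trans (+-comm _ (length w)) (cong (suc (suc j) *_) |w|≡p)))
                 (*-monoˡ-≤ p j<q)))
    open ≡-Reasoning

-- LZ77 gaps

terminated-‼ : ∀ (S : List X) i → i < length S → terminated S ‼ i ≡ Maybe.map just (S ‼ i)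
terminated-‼ (x ∷ S) zero    _        = refl
terminated-‼ (x ∷ S) (suc i) (s≤s i<) = terminated-‼ S i i<

terminated-end : ∀ (S : List X) → terminated S ‼ length S ≡ just nothing
terminated-end []      = refl
terminated-end (x ∷ S) = terminated-end S

terminated-end⁻ : ∀ (S : List X) i → terminated S ‼ i ≡ just nothing → i ≡ length S
terminated-end⁻ []      zero    _  = refl
terminated-end⁻ (x ∷ S) (suc i) eq = cong suc (terminated-end⁻ S i eq)

length-terminated : ∀ (S : List X) → length (terminated S) ≡ suc (length S)
length-terminated []      = refl
length-terminated (x ∷ S) = cong suc (length-terminated S)

terminated-transfer : ∀ (S : List X) i j → i < length S → j < length S →
                      S ‼ i ≡ S ‼ j → terminated S ‼ i ≡ terminated S ‼ j
terminated-transfer S i j i< j< eq =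
  trans (terminated-‼ S i i<) (trans (cong (Maybe.map just) eq) (sym (terminated-‼ S j j<)))

terminated-transfer⁻ : ∀ (S : List X) i j → i < length S → j < length S →
                       terminated S ‼ i ≡ terminated S ‼ j → S ‼ i ≡ S ‼ j
terminated-transfer⁻ S i j i< j< eq =
  map-injective just-injective (trans (sym (terminated-‼ S i i<)) (trans eq (terminated-‼ S j j<)))

module _ (_≟_ : DecidableEquality X) where

  occ-once : ∀ P T → 1 ≤ occ _≟_ P T → ∃ (Occ T P)
  occ-once P []      1≤ with prefix? _≟_ P []
  occ-once P []      1≤ | yes p = 0 , prefix⇒Occ p
  occ-once P (t ∷ T) 1≤ with prefix? _≟_ P (t ∷ T)
  ... | yes p = 0 , prefix⇒Occ p
  ... | no  _ = let c , o = occ-once P T 1≤ in suc c , o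

  occ-twice : ∀ P T → 2 ≤ occ _≟_ P T → ∃₂ λ c₁ c₂ → c₁ < c₂ × Occ T P c₁ × Occ T P c₂
  occ-twice P []      2≤ with prefix? _≟_ P []
  occ-twice P []      (s≤s ()) | yes p
  occ-twice P (t ∷ T) 2≤ with prefix? _≟_ P (t ∷ T)
  ... | yes p = let c , o = occ-once P T (s≤s⁻¹ 2≤) in 0 , suc c , s≤s z≤n , prefix⇒Occ p , o
  ... | no  _ = let c₁ , c₂ , c₁<c₂ , o₁ , o₂ = occ-twice P T 2≤ in suc c₁ , suc c₂ , s≤s c₁<c₂ , o₁ , o₂

  -- The later of two occurrences of `F` in `done ++ F` still fits, so it starts at `length done` at
  -- the latest, and the earlier one starts strictly before. The source may overlap `F`, hence the
  -- equations between positions of the whole string.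
  LZ77-source : ∀ done F rest → IsLZ77Factor _≟_ done F rest → let S = done ++ F ++ rest in
    length F ≡ 1 ⊎
    ∃ λ c → c < length done × (∀ r → r < length F → S ‼ (c + r) ≡ S ‼ (length done + r))
  LZ77-source done F rest (fresh c refl _) = inj₁ refl
  LZ77-source done F rest (copied F≢[] twice _)
    with c , c₂ , c<c₂ , occF , occF₂ ← occ-twice F (done ++ F) twice =
    inj₂ (c , c<done , λ r r< → begin
      S ‼ (c + r)               ≡⟨ cong (_‼ (c + r)) (++-assoc done F rest) ⟨
      ((done ++ F) ++ rest) ‼ (c + r)
        ≡⟨ ‼-++ˡ (done ++ F) rest (c + r) (subst (c + r <_) (sym (length-++ done)) (+-mono-< c<done r<)) ⟩
      (done ++ F) ‼ (c + r)     ≡⟨ occF r r< ⟩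
      F ‼ r                     ≡⟨ ‼-++ˡ F rest r r< ⟨
      (F ++ rest) ‼ r           ≡⟨ ‼-++ʳ done (F ++ rest) r ⟨
      S ‼ (length done + r)     ∎)
    where
    open ≡-Reasoning
    S = done ++ F ++ rest
    c<done : c < length done
    c<done = <-≤-trans c<c₂ (+-cancelʳ-≤ (length F) c₂ (length done)
      (subst (c₂ + length F ≤_) (length-++ done) (Occ-bounded (done ++ F) F c₂ F≢[] occF₂)))

gaps : ℕ → List (List X) → List ℕ
gaps c []       = c ∷ []
gaps c (F ∷ Fs) = c ∷ gaps (c + length F) Fs

length-gaps : ∀ c (Fs : List (List X)) → length (gaps c Fs) ≡ suc (length Fs)
length-gaps c []       = refl
length-gaps c (F ∷ Fs) = cong suc (length-gaps (c + length F) Fs)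

∈-gaps : ∀ c (Fs Gs : List (List X)) → c + length (concat Fs) ∈ gaps c (Fs ++ Gs)
∈-gaps c []       []       = here (+-identityʳ c)
∈-gaps c []       (G ∷ Gs) = here (+-identityʳ c)
∈-gaps c (F ∷ Fs) Gs       = there (subst (_∈ gaps (c + length F) (Fs ++ Gs))
  (trans (+-assoc c (length F) _) (cong (c +_) (sym (length-++ F)))) (∈-gaps (c + length F) Fs Gs))

∈-gaps-end : ∀ c (Fs : List (List X)) F Gs → c + (length (concat Fs) + length F) ∈ gaps c (Fs ++ F ∷ Gs)
∈-gaps-end c Fs F Gs = subst₂ (λ l Hs → c + l ∈ gaps c Hs)
  (trans (cong length (sym (concat-++ Fs [ F ])))
    (trans (length-++ (concat Fs)) (cong (λ l → length (concat Fs) + length l) (++-identityʳ F))))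
  (++-assoc Fs [ F ] Gs) (∈-gaps c (Fs ++ [ F ]) Gs)

locate : ∀ (Fs : List (List X)) j → j < length (concat Fs) →
         ∃₂ λ Gs F → ∃₂ λ Hs i → Fs ≡ Gs ++ F ∷ Hs × j ≡ length (concat Gs) + i × i < length F
locate (F ∷ Fs) j j< with j <? length F
... | yes j<F = [] , F , Fs , j , refl , refl , j<F
... | no  j≮F
  with Gs , F′ , Hs , i , eq , j∸≡ , i< ← locate Fs (j ∸ length F)
    (+-cancelˡ-< (length F) _ _ (subst₂ _<_ (sym (m+[n∸m]≡n (≮⇒≥ j≮F))) (length-++ F) j<)) =
  F ∷ Gs , F′ , Hs , i , cong (F ∷_) eq ,
  trans (sym (m+[n∸m]≡n (≮⇒≥ j≮F))) (trans (cong (length F +_) j∸≡)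
    (trans (sym (+-assoc (length F) _ i)) (cong (_+ i) (sym (length-++ F))))) , i<

module Gaps {a} {A : Set a} (_≟_ : DecidableEquality A) (S : List A) (Fs : List (List A)) (lz : IsLZ77 _≟_ S Fs) where

  f : ℕ → Maybe (Maybe A)
  f = delimited S ‼_

  -- A gap is named by the position of `delimited S` right after it. The first gap, 1, follows the
  -- opening delimiter, and the last one precedes the closing delimiter.
  G : List ℕ
  G = gaps 1 Fs

  private
    n = length S
    T = terminated S
    open IsLZ77 lz

  last-gap : suc n ∈ G
  last-gap = subst₂ (λ w Gs → suc (length w) ∈ gaps 1 Gs) factorization (++-identityʳ Fs) (∈-gaps 1 Fs [])

  first-gap : 1 ∈ G
  first-gap = ∈-gaps 1 [] Fs

  -- d is the end of the factors before the one that contains position d + i, and m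
  -- the length of that factor.
  record Located (j : ℕ) : Set a where
    field
      d m i  : ℕ
      j≡     : j ≡ d + i
      i<m    : i < m
      begin∈ : suc d ∈ G
      end∈   : suc (d + m) ∈ G
      inside : d + m ≤ n
      source : m ≡ 1 ⊎ ∃ λ c → c < d × (∀ r → r < m → T ‼ (c + r) ≡ T ‼ (d + r))

  located : ∀ j → j < n → Located j
  located j j<n
    with Gs , F , Hs , i , refl , j≡ , i<F ← locate Fs j (subst (λ w → j < length w) (sym factorization) j<n) =
    record
      { d = length (concat Gs) ; m = length F ; i = i ; j≡ = j≡ ; i<m = i<F
      ; begin∈ = ∈-gaps 1 Gs (F ∷ Hs) ; end∈ = ∈-gaps-end 1 Gs F Hs ; inside = inside ; source = source }
    where
    S≡ : S ≡ concat Gs ++ F ++ concat Hs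
    S≡ = trans (sym factorization) (sym (concat-++ Gs (F ∷ Hs)))
    inside : length (concat Gs) + length F ≤ n
    inside = subst (length (concat Gs) + length F ≤_)
      (sym (trans (cong length S≡) (trans (length-++ (concat Gs))
        (trans (cong (length (concat Gs) +_) (length-++ F)) (sym (+-assoc (length (concat Gs)) _ _))))))
      (m≤m+n _ _)
    source : length F ≡ 1 ⊎ ∃ λ c → c < length (concat Gs) ×
               (∀ r → r < length F → T ‼ (c + r) ≡ T ‼ (length (concat Gs) + r))
    source with LZ77-source _≟_ (concat Gs) F (concat Hs) (factors Gs F Hs refl)
    ... | inj₁ |F|≡1 = inj₁ |F|≡1
    ... | inj₂ (c , c< , same) = inj₂ (c , c< , λ r r< →
      terminated-transfer S _ _ (<-≤-trans (+-mono-< c< r<) inside) (<-≤-trans (+-monoʳ-< _ r<) inside)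
        (subst (λ S → S ‼ (c + r) ≡ S ‼ (length (concat Gs) + r)) (sym S≡) (same r r<)))

  open Located

  -- The letters of a copied factor also occur further to the left, so following the sources
  -- leftwards ends at a factor of length 1, which begins at a gap. Position `n` of `T` is the
  -- closing delimiter, and the last gap precedes it.
  letter-at-gap : ∀ j → j ≤ n → ∃ λ j′ → suc j′ ∈ G × T ‼ j′ ≡ T ‼ j
  letter-at-gap = <-rec _ step
    where
    step : ∀ j → (∀ {i} → i < j → i ≤ n → ∃ λ j′ → suc j′ ∈ G × T ‼ j′ ≡ T ‼ i) →
           j ≤ n → ∃ λ j′ → suc j′ ∈ G × T ‼ j′ ≡ T ‼ j
    step j rec j≤n with j <? n
    ... | no j≮n = j , subst (λ j → suc j ∈ G) (≤-antisym (≮⇒≥ j≮n) j≤n) last-gap , refl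
    ... | yes j<n with L ← located j j<n with source L
    ...   | inj₁ m≡1 = d L , begin∈ L , cong (T ‼_) (sym (trans (j≡ L)
              (trans (cong (d L +_) (n<1⇒n≡0 (subst (i L <_) m≡1 (i<m L)))) (+-identityʳ (d L)))))
    ...   | inj₂ (c , c<d , same) =
      let c+i<j = subst (c + i L <_) (sym (j≡ L)) (+-monoˡ-< (i L) c<d)
          j′ , gap , eq = rec c+i<j (≤-trans (<⇒≤ c+i<j) j≤n)
      in j′ , gap , trans eq (trans (same (i L) (i<m L)) (cong (T ‼_) (sym (j≡ L))))

  -- The leftmost occurrence of a string of length at least 2 is not inside a factor,
  -- since a copied factor also occurs further to the left.
  crossing : ∀ len k → k + len ≤ n → ∃₂ λ k′ u → u ≤ len × suc (k′ + u) ∈ G ×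
             (∀ r → r ≤ suc len → f (k′ + r) ≡ f (k + r))
  crossing len = <-rec _ step
    where
    step : ∀ k → (∀ {l} → l < k → l + len ≤ n → ∃₂ λ k′ u → u ≤ len × suc (k′ + u) ∈ G ×
             (∀ r → r ≤ suc len → f (k′ + r) ≡ f (l + r))) →
           k + len ≤ n → ∃₂ λ k′ u → u ≤ len × suc (k′ + u) ∈ G ×
             (∀ r → r ≤ suc len → f (k′ + r) ≡ f (k + r))
    -- At `k = 0` the window starts with the opening delimiter, which the first gap follows
    -- directly.
    step zero    rec _ = 0 , 0 , z≤n , first-gap , λ _ _ → refl
    step (suc j) rec j+len<n with L ← located j (≤-<-trans (m≤m+n j len) j+len<n)
      -- The `len + 2` characters take the offsets `i` to `i + suc len` from the start of the factor
      -- containing the first of them. If they do not fit into it, its end is the required gap.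
      with i L + suc len <? m L
    ... | no i+len≮m = suc j , u′ , m≤n+o⇒m∸n≤o (m L) (suc (i L)) (≤-trans (≮⇒≥ i+len≮m) (≤-reflexive (+-suc _ _))) ,
                       subst (_∈ G) (cong suc (sym end≡)) (end∈ L) , λ _ _ → refl
      where
      u′ = m L ∸ suc (i L)
      end≡ : suc (j + u′) ≡ d L + m L
      end≡ = trans (sym (+-suc j u′)) (trans (cong (_+ suc u′) (j≡ L)) (trans (+-assoc (d L) (i L) (suc u′))
        (cong (d L +_) (trans (+-suc (i L) u′) (m+[n∸m]≡n (i<m L))))))
    ... | yes i+len<m with source L
    ...   | inj₁ m≡1 = contradiction (≤-trans (≤-trans (s≤s (s≤s z≤n)) (s≤s (m≤n+m (suc len) (i L)))) i+len<m)
                         λ 2≤m → <-irrefl (sym m≡1) 2≤m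
    ...   | inj₂ (c , c<d , same) =
      let c+i<j = subst (c + i L <_) (sym (j≡ L)) (+-monoˡ-< (i L) c<d)
          k′ , u , u≤ , gap , eq = rec (s≤s c+i<j) (≤-trans (+-monoˡ-≤ len (s≤s (<⇒≤ c+i<j))) j+len<n)
      in k′ , u , u≤ , gap , λ r r≤ → trans (eq r r≤) (begin
        T ‼ (c + i L + r)     ≡⟨ cong (T ‼_) (+-assoc c (i L) r) ⟩
        T ‼ (c + (i L + r))   ≡⟨ same (i L + r) (≤-<-trans (+-monoʳ-≤ (i L) r≤) i+len<m) ⟩
        T ‼ (d L + (i L + r)) ≡⟨ cong (T ‼_) (+-assoc (d L) (i L) r) ⟨
        T ‼ (d L + i L + r)   ≡⟨ cong (λ j → T ‼ (j + r)) (j≡ L) ⟨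
        T ‼ (j + r)           ∎)
      where open ≡-Reasoning

-- Right extensions

prefix-terminated : ∀ {P S : List X} → Prefix _≡_ P S → Prefix _≡_ (map just P) (terminated S)
prefix-terminated []         = []
prefix-terminated (refl ∷ p) = refl ∷ prefix-terminated p

prefix-∷ʳ : ∀ (T P : List X) x → Occ T P 0 → T ‼ length P ≡ just x → Prefix _≡_ (P ∷ʳ x) T
prefix-∷ʳ T P x occ eq = Occ⇒prefix T (P ∷ʳ x) (Occ-++⁺ T P [ x ] 0 occ (Occ-[] T x (length P) eq))

occ-∷ : ∀ (_≟_ : DecidableEquality X) P x T → occ _≟_ P T ≤ occ _≟_ P (x ∷ T)
occ-∷ _≟_ P x T with prefix? _≟_ P (x ∷ T)
... | yes _ = n≤1+n _
... | no  _ = ≤-refl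

occ-hit : ∀ (_≟_ : DecidableEquality X) P x T → Prefix _≡_ P (x ∷ T) → occ _≟_ P (x ∷ T) ≡ suc (occ _≟_ P T)
occ-hit _≟_ P x T pre = cong length (filter-accept (prefix? _≟_ P) {xs = tails T} pre)

occ-miss : ∀ (_≟_ : DecidableEquality X) P x T → ¬ Prefix _≡_ P (x ∷ T) → occ _≟_ P (x ∷ T) ≡ occ _≟_ P T
occ-miss _≟_ P x T ¬pre = cong length (filter-reject (prefix? _≟_ P) {xs = tails T} ¬pre)

module _ (_≟_ : DecidableEquality X) where

  private
    _≟′_ = Maybe-≡-dec _≟_

  -- Each occurrence of the longer string contains one of `p ∷ P` one place further on. Both counts
  -- are followed along `S`, with `y` the character before the unread part, until an occurrence of
  -- `p ∷ P` has no counterpart. In the base case `p ∷ P` does not occur in `[]`.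
  not-always-preceded : ∀ p P x y S →
    occ _≟′_ (x ∷ map just (p ∷ P)) (y ∷ terminated S) < occ _≟_ (p ∷ P) S →
    ∃ λ c → Occ (terminated S) (map just (p ∷ P)) c × (y ∷ terminated S) ‼ c ≢ just x
  not-always-preceded p P x y []      ()
  not-always-preceded p P x y (s ∷ S) lt =
    choose (prefix? _≟_ (p ∷ P) (s ∷ S)) (prefix? _≟′_ xP (y ∷ terminated (s ∷ S)))
    where
    xP = x ∷ map just (p ∷ P)
    later : occ _≟′_ xP (terminated (s ∷ S)) < occ _≟_ (p ∷ P) S →
            ∃ λ c → Occ (terminated (s ∷ S)) (map just (p ∷ P)) c × (y ∷ terminated (s ∷ S)) ‼ c ≢ just x
    later lt = let c , o , ne = not-always-preceded p P x (just s) S lt in suc c , o , ne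
    choose : Dec (Prefix _≡_ (p ∷ P) (s ∷ S)) → Dec (Prefix _≡_ xP (y ∷ terminated (s ∷ S))) →
             ∃ λ c → Occ (terminated (s ∷ S)) (map just (p ∷ P)) c × (y ∷ terminated (s ∷ S)) ‼ c ≢ just x
    choose (yes pre) (no ¬pre)  = 0 , prefix⇒Occ (prefix-terminated pre) ,
                                  λ { refl → ¬pre (refl ∷ prefix-terminated pre) }
    choose (yes pre) (yes pre′) = later (s≤s⁻¹ (subst₂ _<_ (occ-hit _≟′_ xP y _ pre′) (occ-hit _≟_ _ s S pre) lt))
    choose (no ¬pre) _          = later (≤-<-trans (occ-∷ _≟′_ xP y (terminated (s ∷ S)))
                                         (<-≤-trans lt (≤-reflexive (occ-miss _≟_ _ s S ¬pre))))

  not-always-followed : ∀ p P x S →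
    occ _≟′_ (map just (p ∷ P) ∷ʳ x) (terminated S) < occ _≟_ (p ∷ P) S →
    ∃ λ c → Occ (terminated S) (map just (p ∷ P)) c × terminated S ‼ (c + length (map just (p ∷ P))) ≢ just x
  not-always-followed p P x []      ()
  not-always-followed p P x (s ∷ S) lt =
    choose (prefix? _≟_ (p ∷ P) (s ∷ S)) (prefix? _≟′_ Px (terminated (s ∷ S)))
    where
    Px = map just (p ∷ P) ∷ʳ x
    later : occ _≟′_ Px (terminated S) < occ _≟_ (p ∷ P) S →
            ∃ λ c → Occ (terminated (s ∷ S)) (map just (p ∷ P)) c ×
             terminated (s ∷ S) ‼ (c + length (map just (p ∷ P))) ≢ just x
    later lt = let c , o , ne = not-always-followed p P x S lt in suc c , o , ne
    choose : Dec (Prefix _≡_ (p ∷ P) (s ∷ S)) → Dec (Prefix _≡_ Px (terminated (s ∷ S))) →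
             ∃ λ c → Occ (terminated (s ∷ S)) (map just (p ∷ P)) c ×
             terminated (s ∷ S) ‼ (c + length (map just (p ∷ P))) ≢ just x
    choose (yes pre) (no ¬pre)  =
      let o = prefix⇒Occ (prefix-terminated pre) in
      0 , o , λ eq → ¬pre (prefix-∷ʳ (terminated (s ∷ S)) (map just (p ∷ P)) x o eq)
    choose (yes pre) (yes pre′) = later (s≤s⁻¹ (subst₂ _<_ (occ-hit _≟′_ Px _ _ pre′) (occ-hit _≟_ _ s S pre) lt))
    choose (no ¬pre) _          = later (≤-<-trans (occ-∷ _≟′_ Px (just s) (terminated S))
                                         (<-≤-trans lt (≤-reflexive (occ-miss _≟_ _ s S ¬pre))))

≢[]⇒0<length : ∀ {xs : List X} → xs ≢ [] → 0 < length xs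
≢[]⇒0<length {xs = []}    ne = contradiction refl ne
≢[]⇒0<length {xs = _ ∷ _} _  = s≤s z≤n

-- `S ^ʷ 0` and `S ^ʷ 1` are the empty string and `S`, both of which occur in `S`.
power-free⇒2≤ : ∀ (S : List X) q → S ≢ [] → PowerFree q S → 2 ≤ q
power-free⇒2≤ S zero          S≢[] free = contradiction (here []) (free S S≢[])
power-free⇒2≤ S (suc zero)    S≢[] free = contradiction
  (Occ⇒infix S (S ++ []) 0 z≤n (subst (λ W → Occ S W 0) (sym (++-identityʳ S)) λ _ _ → refl)) (free S S≢[])
power-free⇒2≤ S (suc (suc q)) _    _    = s≤s (s≤s z≤n)

module Extensions {a} {A : Set a} (_≟_ : DecidableEquality A) (S : List A) (q : ℕ) (Fs : List (List A))
  (S≢[] : S ≢ []) (free : PowerFree q S) (lz : IsLZ77 _≟_ S Fs) where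

  open Gaps _≟_ S Fs lz public

  n : ℕ
  n = length S

  T : List (Maybe A)
  T = terminated S

  2≤q : 2 ≤ q
  2≤q = power-free⇒2≤ S q S≢[] free

  no-power : ∀ c p → 0 < c → 0 < p → c + q * p ≤ suc n →
             ¬ (∀ x → x + p < q * p → f (c + (x + p)) ≡ f (c + x))
  no-power (suc c) p _ 0<p (s≤s c+qp≤n) per =
    ^ʷ-period-free S q (≤-trans (s≤s z≤n) 2≤q) free c p 0<p c+qp≤n λ x x+p<qp →
      let <n = <-≤-trans (+-monoʳ-< c x+p<qp) c+qp≤n in
      terminated-transfer⁻ S _ _ <n (≤-<-trans (+-monoʳ-≤ c (m≤m+n x p)) <n) (per x x+p<qp)

  open Pairs (Maybe-≡-dec (Maybe-≡-dec _≟_)) f n q G (≢[]⇒0<length S≢[]) 2≤q no-power public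
  open Pair public

  -- Position `k` of `T` is position `suc k` of `f`, so `Q` is the string `P a` that follows the
  -- character `f k`.
  Represents : List (Maybe A) → Pair → Set a
  Represents Q π = length Q ≡ suc (len π) × Occ T Q (k π)

  represents-injective : ∀ {Q Q′} (r : ∃ (Represents Q)) (r′ : ∃ (Represents Q′)) →
                         proj₁ r ≋ proj₁ r′ → Q ≡ Q′
  represents-injective {Q} {Q′} (_ , |Q| , occQ) (_ , |Q′| , occQ′) (refl , _ , refl) =
    ‼-ext Q Q′ |Q|≡|Q′| λ r r< → trans (sym (occQ r r<)) (occQ′ r (subst (r <_) |Q|≡|Q′| r<))
    where
    |Q|≡|Q′| = trans |Q| (sym |Q′|)

  -- The occurrence at `c₀` avoids the closing delimiter, so `P` does not end in it, and then no
  -- occurrence of `P` reaches it.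
  Occ-inside : ∀ P c₀ → P ≢ [] → Occ T P c₀ → c₀ + length P ≤ n → ∀ c → Occ T P c → c + length P ≤ n
  Occ-inside [] c₀ P≢[] _ _ c _ = contradiction refl P≢[]
  Occ-inside (p ∷ P) c₀ P≢[] occ₀ ≤n c occ =
    s≤s⁻¹ (≤∧≢⇒< (subst (c + length (p ∷ P) ≤_) (length-terminated S) (Occ-bounded T (p ∷ P) c P≢[] occ)) not-end)
    where
    not-end : c + length (p ∷ P) ≢ suc n
    not-end eq = <-irrefl c₀+|P|≡n (≤-trans (≤-reflexive (sym (+-suc c₀ (length P)))) ≤n)
      where
      c+|P|≡n : c + length P ≡ n
      c+|P|≡n = suc-injective (trans (sym (+-suc c (length P))) eq)
      c₀+|P|≡n : c₀ + length P ≡ n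
      c₀+|P|≡n = terminated-end⁻ S _ (begin
        T ‼ (c₀ + length P)    ≡⟨ occ₀ (length P) ≤-refl ⟩
        (p ∷ P) ‼ length P     ≡⟨ occ (length P) ≤-refl ⟨
        T ‼ (c + length P)     ≡⟨ cong (T ‼_) c+|P|≡n ⟩
        T ‼ n                  ≡⟨ terminated-end S ⟩
        just nothing           ∎)
        where open ≡-Reasoning

  Occ-∷ʳ-inside : ∀ P x c → Occ T (P ∷ʳ x) c → c + length P ≤ n
  Occ-∷ʳ-inside P x c occ =
    s≤s⁻¹ (subst (c + length P <_) (length-terminated S) (‼-just⇒< T _ (Occ-∷ʳ T P x c occ)))

  -- `crossing` moves an occurrence of `P` together with its two neighbouring characters, so both
  -- mismatches survive the move to a gap.
  make-pair : ∀ P a k k′ → Occ T (P ∷ʳ a) k → Occ T P k′ → k′ + length P ≤ n →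
              f k ≢ f k′ → T ‼ (k′ + length P) ≢ just a → ∃ λ π → Represents (P ∷ʳ a) π
  make-pair P a k k′ occ occ′ k′≤ ne ne-right
    with k₁ , u , u≤ , gap , eq ← crossing (length P) k (Occ-∷ʳ-inside P a k occ)
       | k₁′ , u′ , u′≤ , gap′ , eq′ ← crossing (length P) k′ k′≤ = record
    { k = k₁ ; k′ = k₁′ ; len = ℓ ; u = u ; u′ = u′ ; u≤len = u≤ ; u′≤len = u′≤ ; gap∈ = gap ; gap′∈ = gap′
    ; mismatch = λ e → ne (trans (sym (first k₁ k eq)) (trans e (first k₁′ k′ eq′)))
    ; match = λ r r< → trans (later k₁ k eq r (<⇒≤ r<)) (trans (Occ-++⁻ˡ T P [ a ] k occ r r<)
        (trans (sym (occ′ r r<)) (sym (later k₁′ k′ eq′ r (<⇒≤ r<)))))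
    ; mismatchʳ = λ e → ne-right (trans (sym (later k₁′ k′ eq′ ℓ ≤-refl)) (trans (sym e)
        (trans (later k₁ k eq ℓ ≤-refl) (Occ-∷ʳ T P a k occ))))
    ; bounded = within k₁ k eq (Occ-∷ʳ-inside P a k occ) ; bounded′ = within k₁′ k′ eq′ k′≤ } ,
    trans (length-++ P) (+-comm ℓ 1) ,
    λ r r< → trans (later k₁ k eq r (s≤s⁻¹ (subst (r <_) (trans (length-++ P) (+-comm ℓ 1)) r<))) (occ r r<)
    where
    ℓ = length P
    first : ∀ i j → (∀ r → r ≤ suc ℓ → f (i + r) ≡ f (j + r)) → f i ≡ f j
    first i j eq = subst₂ (λ i j → f i ≡ f j) (+-identityʳ i) (+-identityʳ j) (eq 0 z≤n)
    later : ∀ i j → (∀ r → r ≤ suc ℓ → f (i + r) ≡ f (j + r)) → ∀ r → r ≤ ℓ → T ‼ (i + r) ≡ T ‼ (j + r)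
    later i j eq r r≤ = subst₂ (λ i j → f i ≡ f j) (+-suc i r) (+-suc j r) (eq (suc r) (s≤s r≤))
    within : ∀ i j → (∀ r → r ≤ suc ℓ → f (i + r) ≡ f (j + r)) → j + ℓ ≤ n → i + ℓ ≤ n
    within i j eq j≤ with x , Tj ← <⇒‼-just T (j + ℓ) (subst (j + ℓ <_) (sym (length-terminated S)) (s≤s j≤)) =
      s≤s⁻¹ (subst (i + ℓ <_) (length-terminated S) (‼-just⇒< T _ (trans (later i j eq ℓ ≤-refl) Tj)))

  -- If c₁ does not already differ from c₀ on the left, then c₂ differs from both on
  -- the left and is paired with whichever of them it differs from on the right.
  extension-pair : ∀ P a c₀ c₁ c₂ → P ≢ [] → Occ T (P ∷ʳ a) c₀ → Occ T P c₁ → Occ T P c₂ →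
    T ‼ (c₁ + length P) ≢ just a → f c₂ ≢ f c₀ → ∃ λ π → Represents (P ∷ʳ a) π
  extension-pair P a c₀ c₁ c₂ P≢[] occ₀ occ₁ occ₂ ne₁ ne₂ = choose
    (Maybe-≡-dec (Maybe-≡-dec _≟_) (f c₀) (f c₁)) (Maybe-≡-dec (Maybe-≡-dec _≟_) (T ‼ (c₂ + length P)) (just a))
    where
    inside : ∀ c → Occ T P c → c + length P ≤ n
    inside = Occ-inside P c₀ P≢[] (Occ-++⁻ˡ T P [ a ] c₀ occ₀) (Occ-∷ʳ-inside P a c₀ occ₀)
    choose : Dec (f c₀ ≡ f c₁) → Dec (T ‼ (c₂ + length P) ≡ just a) → ∃ λ π → Represents (P ∷ʳ a) π
    choose (no c₀≢c₁) _ = make-pair P a c₀ c₁ occ₀ occ₁ (inside c₁ occ₁) c₀≢c₁ ne₁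
    choose (yes _) (no ne) = make-pair P a c₀ c₂ occ₀ occ₂ (inside c₂ occ₂) (ne₂ ∘ sym) ne
    choose (yes c₀≡c₁) (yes eq) =
      make-pair P a c₂ c₁ occ₂a occ₁ (inside c₁ occ₁) (λ e → ne₂ (trans e (sym c₀≡c₁))) ne₁
      where
      occ₂a : Occ T (P ∷ʳ a) c₂
      occ₂a = Occ-++⁺ T P [ a ] c₂ occ₂ (Occ-[] T a _ eq)

  right-extension-pair : ∀ {Q} → IsRightExtension _≟_ S Q → ∃ (Represents Q)
  right-extension-pair ([] , x , maximal , _) = contradiction refl (IsMaximalRepeat.nonempty maximal)
  right-extension-pair (p ∷ P , x , maximal , refl , infixQ)
    with c₀ , _ , occ₀ ← infix⇒Occ infixQ
    with x₀ , fc₀≡ ← <⇒‼-just (delimited S) c₀ (m<n⇒m<1+n (‼-just⇒< T c₀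
           (trans (cong (T ‼_) (sym (+-identityʳ c₀))) (occ₀ 0 (s≤s z≤n)))))
    -- Maximality is applied on the right to `x` and on the left to `x₀`, the character that
    -- precedes the given occurrence.
    with c₁ , occ₁ , ne₁ ← not-always-followed _≟_ p P x S
           (≤-<-trans (occ-∷ (Maybe-≡-dec _≟_) (map just (p ∷ P) ∷ʳ x) nothing T) (IsMaximalRepeat.right maximal x))
       | c₂ , occ₂ , ne₂ ← not-always-preceded _≟_ p P x₀ nothing S (IsMaximalRepeat.left maximal x₀) =
    extension-pair (map just (p ∷ P)) x c₀ c₁ c₂ (λ ()) occ₀ occ₁ occ₂ ne₁ λ e → ne₂ (trans e fc₀≡)

  E : ℕ
  E = ((q * n) ^ (q + q) * ((q * n) ^ (q + q) * (q * n) ^ (q + q))) ^ (length G * length G)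

  number-right-extensions : Number (IsRightExtension _≟_ S) _≡_ (λ N → q ^ N ≤ E)
  number-right-extensions = number-via (λ N → q ^ N ≤ E) (λ ext → proj₁ (right-extension-pair ext)) (λ _ → tt)
    (λ e e′ → represents-injective (right-extension-pair e) (right-extension-pair e′))
    number-pairs

  -- CDAWG arcs

  open SuffixTree T
  open Merging IsArc

  private
    M = Maybe A

  -- These are the properties by which the suffix tree recognises its nodes. Quantifying over `y`
  -- makes the relation stable under appending, so it covers all strings below `u` and `w`.
  record _⊑_ (u w : List M) : Set a where
    field
      empty  : ∀ y → u ++ y ≡ [] → w ++ y ≡ []
      infix′ : ∀ y → Infix _≡_ (u ++ y) T → Infix _≡_ (w ++ y) T
      suffix : ∀ y → Suffix _≡_ (u ++ y) T → Suffix _≡_ (w ++ y) T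

  open _⊑_

  _∼_ : Rel (List M) a
  u ∼ w = u ⊑ w × w ⊑ u

  ∼-refl : ∀ {u} → u ∼ u
  ∼-refl = ⊑-refl , ⊑-refl
    where
    ⊑-refl : ∀ {u} → u ⊑ u
    ⊑-refl = record { empty = λ _ → id ; infix′ = λ _ → id ; suffix = λ _ → id }

  ∼-sym : ∀ {u w} → u ∼ w → w ∼ u
  ∼-sym (u⊑w , w⊑u) = w⊑u , u⊑w

  ∼-trans : ∀ {u v w} → u ∼ v → v ∼ w → u ∼ w
  ∼-trans (u⊑v , v⊑u) (v⊑w , w⊑v) = ⊑-trans u⊑v v⊑w , ⊑-trans w⊑v v⊑u
    where
    ⊑-trans : ∀ {u v w} → u ⊑ v → v ⊑ w → u ⊑ w
    ⊑-trans p q = record { empty = λ y → empty q y ∘ empty p y ; infix′ = λ y → infix′ q y ∘ infix′ p y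
                         ; suffix = λ y → suffix q y ∘ suffix p y }

  ∼-++ : ∀ {u w} x → u ∼ w → (u ++ x) ∼ (w ++ x)
  ∼-++ x (u⊑w , w⊑u) = ⊑-++ u⊑w , ⊑-++ w⊑u
    where
    ⊑-++ : ∀ {u w} → u ⊑ w → (u ++ x) ⊑ (w ++ x)
    ⊑-++ {u} {w} p = record
      { empty = λ y → subst₂ (λ v v′ → v ≡ [] → v′ ≡ []) (sym (++-assoc u x y)) (sym (++-assoc w x y)) (empty p (x ++ y))
      ; infix′ = λ y → subst₂ (λ v v′ → Infix _≡_ v T → Infix _≡_ v′ T) (sym (++-assoc u x y)) (sym (++-assoc w x y))
                         (infix′ p (x ++ y))
      ; suffix = λ y → subst₂ (λ v v′ → Suffix _≡_ v T → Suffix _≡_ v′ T) (sym (++-assoc u x y)) (sym (++-assoc w x y))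
                         (suffix p (x ++ y)) }

  node-∼ : ∀ {u w} → u ∼ w → IsNode u → IsNode w
  node-∼ {u} {w} (u⊑w , w⊑u) (inj₁ u≡[]) =
    inj₁ (trans (sym (++-identityʳ w)) (empty u⊑w [] (trans (++-identityʳ u) u≡[])))
  node-∼ (u⊑w , w⊑u) (inj₂ (inj₁ (x , y , x≢y , ux , uy))) =
    inj₂ (inj₁ (x , y , x≢y , infix′ u⊑w [ x ] ux , infix′ u⊑w [ y ] uy))
  node-∼ {u} {w} (u⊑w , w⊑u) (inj₂ (inj₂ (u≢[] , suf))) = inj₂ (inj₂
    ((λ w≡[] → u≢[] (trans (sym (++-identityʳ u)) (empty w⊑u [] (trans (++-identityʳ w) w≡[])))) ,
     subst (λ v → Suffix _≡_ v T) (++-identityʳ w)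
       (suffix u⊑w [] (subst (λ v → Suffix _≡_ v T) (sym (++-identityʳ u)) suf))))

  arc-∼ : ∀ {u w x v} → u ∼ w → IsArc (u , x , v) → IsArc (w , x , w ++ x)
  arc-∼ {u} {w} {x} u∼w (arc nodeU nodeV x≢[] refl direct) =
    arc (node-∼ u∼w nodeU) (node-∼ (∼-++ x u∼w) nodeV) x≢[] refl
      λ y z x≡ y≢[] z≢[] node → direct y z x≡ y≢[] z≢[] (node-∼ (∼-sym (∼-++ y u∼w)) node)

  drop-length-++ : ∀ (u y : List M) → drop (length u) (u ++ y) ≡ y
  drop-length-++ []      y = refl
  drop-length-++ (_ ∷ u) y = drop-length-++ u y

  descendant-extends : ∀ {u w} → Descendant u w → ∃ λ y → w ≡ u ++ y
  descendant-extends {u} ε = [] , sym (++-identityʳ u)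
  descendant-extends {u} ((x , arc _ _ _ refl _) ◅ path) =
    let y , w≡ = descendant-extends path in x ++ y , trans w≡ (++-assoc u x y)

  -- The subtree at u is carried to the subtree at w by replacing the prefix u by w.
  ∼⇒≅ : ∀ {u w} → u ∼ w → u ≅ w
  ∼⇒≅ {u} {w} u∼w = record
    { to = replace u w ; from = replace w u
    ; to-root = root u w ; from-root = root w u
    ; to-desc = desc u∼w ; from-desc = desc (∼-sym u∼w)
    ; from-to = inverse u w ; to-from = inverse w u
    ; to-arc = replace-arc u∼w ; from-arc = replace-arc (∼-sym u∼w) }
    where
    replace : List M → List M → List M → List M
    replace u w v = w ++ drop (length u) v
    replace-++ : ∀ u w y → replace u w (u ++ y) ≡ w ++ y
    replace-++ u w y = cong (w ++_) (drop-length-++ u y)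
    root : ∀ u w → replace u w u ≡ w
    root u w = trans (cong (replace u w) (sym (++-identityʳ u))) (trans (replace-++ u w []) (++-identityʳ w))
    inverse : ∀ u w {v} → Descendant u v → replace w u (replace u w v) ≡ v
    inverse u w d with y , refl ← descendant-extends d =
      trans (cong (replace w u) (replace-++ u w y)) (replace-++ w u y)
    replace-arc : ∀ {u w} → u ∼ w → ∀ {v x v′} → Descendant u v → IsArc (v , x , v′) →
                  IsArc (replace u w v , x , replace u w v′)
    replace-arc {u} {w} u∼w {x = x} d e@(arc _ _ _ refl _) with y , refl ← descendant-extends d =
      subst₂ (λ v v′ → IsArc (v , x , v′)) (sym (replace-++ u w y))
        (trans (++-assoc w y x) (trans (sym (replace-++ u w (y ++ x))) (cong (replace u w) (sym (++-assoc u y x)))))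
        (arc-∼ (∼-++ y u∼w) e)
    desc : ∀ {u w} → u ∼ w → ∀ {v} → Descendant u v → Descendant w (replace u w v)
    desc {u} {w} u∼w {v} d = subst (λ s → Descendant s (replace u w v)) (root u w) (go ε d)
      where
      -- The path from `u` is carried along because `replace-arc` works on strings that extend `u`.
      go : ∀ {s} → Descendant u s → Descendant s v → Descendant (replace u w s) (replace u w v)
      go _ ε = ε
      go before ((x , e) ◅ after) = (x , replace-arc u∼w before e) ◅ go (before ◅◅ ((x , e) ◅ ε)) after

  compare-lists : ∀ (x y : List M) → x ≡ y ⊎ (∃ λ z → z ≢ [] × y ≡ x ++ z) ⊎ (∃ λ z → z ≢ [] × x ≡ y ++ z) ⊎
    ∃ λ w → ∃₂ λ c d → ∃₂ λ r s → c ≢ d × x ≡ w ++ c ∷ r × y ≡ w ++ d ∷ s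
  compare-lists []      []      = inj₁ refl
  compare-lists []      (d ∷ y) = inj₂ (inj₁ (d ∷ y , (λ ()) , refl))
  compare-lists (c ∷ x) []      = inj₂ (inj₂ (inj₁ (c ∷ x , (λ ()) , refl)))
  compare-lists (c ∷ x) (d ∷ y) with Maybe-≡-dec _≟_ c d
  ... | no c≢d = inj₂ (inj₂ (inj₂ ([] , c , d , x , y , c≢d , refl , refl)))
  ... | yes refl with compare-lists x y
  ...   | inj₁ x≡y = inj₁ (cong (c ∷_) x≡y)
  ...   | inj₂ (inj₁ (z , z≢ , y≡)) = inj₂ (inj₁ (z , z≢ , cong (c ∷_) y≡))
  ...   | inj₂ (inj₂ (inj₁ (z , z≢ , x≡))) = inj₂ (inj₂ (inj₁ (z , z≢ , cong (c ∷_) x≡)))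
  ...   | inj₂ (inj₂ (inj₂ (w , c′ , d′ , r , s , ne , x≡ , y≡))) =
    inj₂ (inj₂ (inj₂ (c ∷ w , c′ , d′ , r , s , ne , cong (c ∷_) x≡ , cong (c ∷_) y≡)))

  infix-++ˡ : ∀ v w → Infix _≡_ (v ++ w) T → Infix _≡_ v T
  infix-++ˡ v w i = let c , c≤ , occ = infix⇒Occ i in Occ⇒infix T v c c≤ (Occ-++⁻ˡ T v w c occ)

  node⇒infix : ∀ {v} → IsNode v → Infix _≡_ v T
  node⇒infix (inj₁ refl) = here []
  node⇒infix {v} (inj₂ (inj₁ (x , _ , _ , vx , _))) = infix-++ˡ v [ x ] vx
  node⇒infix {v} (inj₂ (inj₂ (v≢[] , suf))) =
    let c , occ , eq = suffix⇒Occ suf in Occ⇒infix T v c (m+n≤o⇒m≤o c (≤-reflexive eq)) occ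

  not-extended : ∀ {u a x z v v′} → z ≢ [] → IsArc (u , a ∷ x , v) → ¬ IsArc (u , a ∷ x ++ z , v′)
  not-extended {a = a} {x} {z} z≢[] (arc _ node _ refl _) (arc _ _ _ _ direct) =
    direct (a ∷ x) z refl (λ ()) z≢[] node

  -- If one label were a proper prefix of the other, its target would be a node in the middle of the
  -- other arc. If the labels diverged after `a`, the point of divergence would be a branching node
  -- in the middle of both.
  label-unique : ∀ {u a x x′ v v′} → IsArc (u , a ∷ x , v) → IsArc (u , a ∷ x′ , v′) → x ≡ x′
  label-unique {u} {a} {x} {x′} e e′ with compare-lists x x′
  ... | inj₁ x≡x′ = x≡x′
  ... | inj₂ (inj₁ (z , z≢[] , refl)) = contradiction e′ (not-extended z≢[] e)
  ... | inj₂ (inj₂ (inj₁ (z , z≢[] , refl))) = contradiction e (not-extended z≢[] e′)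
  ... | inj₂ (inj₂ (inj₂ (w , c , d , r , s , c≢d , refl , refl))) = contradiction
    (inj₂ (inj₁ (c , d , c≢d , branch c r (target e) , branch d s (target e′))))
    (diverging e)
    where
    target : ∀ {x v} → IsArc (u , x , v) → Infix _≡_ (u ++ x) T
    target (arc _ node _ refl _) = node⇒infix node
    branch : ∀ c r → Infix _≡_ (u ++ a ∷ w ++ c ∷ r) T → Infix _≡_ ((u ++ a ∷ w) ∷ʳ c) T
    branch c r i = infix-++ˡ ((u ++ a ∷ w) ∷ʳ c) r (subst (λ v → Infix _≡_ v T)
      (sym (trans (++-assoc (u ++ a ∷ w) [ c ] r) (++-assoc u (a ∷ w) (c ∷ r)))) i)
    diverging : ∀ {v} → IsArc (u , a ∷ w ++ c ∷ r , v) → ¬ IsNode (u ++ a ∷ w)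
    diverging (arc _ _ _ _ direct) = direct (a ∷ w) (c ∷ r) refl (λ ()) (λ ())

  same-arc : ∀ {u u′ a x x′ v v′} → u ∼ u′ → IsArc (u , a ∷ x , v) → IsArc (u′ , a ∷ x′ , v′) →
             (u , a ∷ x , v) ≈ (u′ , a ∷ x′ , v′)
  same-arc {u} {u′} {a} u∼u′ e e′ with refl ← label-unique (arc-∼ u∼u′ e) e′ = ∼⇒≅ u∼u′ , refl , targets e e′
    where
    targets : ∀ {x v v′} → IsArc (u , x , v) → IsArc (u′ , x , v′) → v ≅ v′
    targets {x} (arc _ _ _ refl _) (arc _ _ _ refl _) = ∼⇒≅ (∼-++ x u∼u′)

  -- Left-maximal extensions of nodes

  Preceded : List M → List M → Set a
  Preceded l u = ∀ c → Occ T u c → ∃ λ d → c ≡ d + length l × Occ T l d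

  -- Moving by `length l` is a bijection between the occurrences of `l ++ u ++ y` and those of
  -- `u ++ y`. It keeps the right ends in place, so suffixes correspond to suffixes.
  preceded⇒∼ : ∀ l u → u ≢ [] → Preceded l u → u ∼ (l ++ u)
  preceded⇒∼ l u u≢[] preceded = record
    { empty  = λ y eq → contradiction (++-conicalˡ u y eq) u≢[]
    ; infix′ = λ y i → let c , c≤ , occ = infix⇒Occ i
                           d , c≡ , occ′ = before y c occ
                       in Occ⇒infix T _ d (≤-trans (m≤m+n d (length l)) (≤-trans (≤-reflexive (sym c≡)) c≤)) occ′
    ; suffix = λ y s → let c , occ , eq = suffix⇒Occ s
                           d , c≡ , occ′ = before y c occ
                       in Occ⇒suffix T _ d occ′ (trans (shift y d) (trans (cong (_+ length (u ++ y)) (sym c≡)) eq)) } ,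
    record
    { empty  = λ y eq → contradiction (++-conicalʳ l u (++-conicalˡ (l ++ u) y eq)) u≢[]
    ; infix′ = λ y i → let c , _ , occ = infix⇒Occ i
                           occ′ = after y c occ
                       in Occ⇒infix T _ (c + length l)
                            (m+n≤o⇒m≤o _ (Occ-bounded T (u ++ y) _ (u≢[] ∘ ++-conicalˡ u y) occ′)) occ′
    ; suffix = λ y s → let c , occ , eq = suffix⇒Occ s
                       in Occ⇒suffix T _ (c + length l) (after y c occ) (trans (sym (shift y c)) eq) }
    where
    before : ∀ y c → Occ T (u ++ y) c → ∃ λ d → c ≡ d + length l × Occ T ((l ++ u) ++ y) d
    before y c occ with d , refl , occ-l ← preceded c (Occ-++⁻ˡ T u y c occ) =
      d , refl , subst (λ W → Occ T W d) (sym (++-assoc l u y)) (Occ-++⁺ T l (u ++ y) d occ-l occ)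
    after : ∀ y c → Occ T ((l ++ u) ++ y) c → Occ T (u ++ y) (c + length l)
    after y c occ = Occ-++⁻ʳ T l (u ++ y) c (subst (λ W → Occ T W c) (++-assoc l u y) occ)
    shift : ∀ y d → d + length ((l ++ u) ++ y) ≡ d + length l + length (u ++ y)
    shift y d = trans (cong (d +_) (trans (cong length (++-assoc l u y)) (length-++ l))) (sym (+-assoc d (length l) _))

  occ? : ∀ W c → Dec (Occ T W c)
  occ? W c = map′ (λ h r → h {r}) (λ h {r} → h r)
    (allUpTo? (λ r → Maybe-≡-dec (Maybe-≡-dec _≟_) (T ‼ (c + r)) (W ‼ r)) (length W))

  -- `f d` is the character of `$S$` before position `d` of `T`, so `differ` says that `l ++ u`
  -- cannot be extended further to the left.
  record LeftMaximal (u : List M) (c₀ : ℕ) : Set a where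
    field
      l        : List M
      d₀ d₁    : ℕ
      c₀≡      : c₀ ≡ d₀ + length l
      occ-l    : Occ T l d₀
      preceded : Preceded l u
      occ₁     : Occ T (l ++ u) d₁
      differ   : f d₁ ≢ f d₀

  -- While all occurrences of `l ++ u` have the same character before them, it is prepended to `l`.
  -- This stops before the start of `S` is passed: an occurrence at 0 is preceded by the opening
  -- delimiter, and one at a later position by a letter.
  left-maximal : ∀ u c₀ c₁ → u ≢ [] → Occ T u c₀ → Occ T u c₁ → c₀ ≢ c₁ → c₀ + length u ≤ n → LeftMaximal u c₀
  left-maximal u c₀ c₁ u≢[] occ₀ occ₁ c₀≢c₁ c₀+u≤n =
    extend c₀ [] (sym (+-identityʳ c₀)) (λ _ ()) λ c _ → c , sym (+-identityʳ c) , λ _ ()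
    where
    0<|u| : 0 < length u
    0<|u| = ≢[]⇒0<length u≢[]
    e<n : ∀ e {k} → c₀ ≡ suc e + k → e < n
    e<n e {k} c₀≡ = ≤-trans (m≤m+n (suc e) k) (subst (_≤ n) c₀≡ (m+n≤o⇒m≤o c₀ c₀+u≤n))
    extend : ∀ d₀ l → c₀ ≡ d₀ + length l → Occ T l d₀ → Preceded l u → LeftMaximal u c₀
    extend d₀ l c₀≡ occ-l preceded
      with anyUpTo? (λ d → occ? (l ++ u) d ×-dec ¬? (Maybe-≡-dec (Maybe-≡-dec _≟_) (f d) (f d₀))) (suc n)
    ... | yes (d₁ , _ , occ₁ , differ) = record
      { l = l ; d₀ = d₀ ; d₁ = d₁ ; c₀≡ = c₀≡ ; occ-l = occ-l ; preceded = preceded ; occ₁ = occ₁ ; differ = differ }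
    ... | no none = step d₀ c₀≡ occ-l always
      where
      starts : ∀ d → Occ T (l ++ u) d → d < suc n
      starts d occ = subst (d <_) (length-terminated S) (<-≤-trans (m<m+n d
        (subst (0 <_) (sym (length-++ l)) (<-≤-trans 0<|u| (m≤n+m _ _))))
        (Occ-bounded T (l ++ u) d (u≢[] ∘ ++-conicalʳ l u) occ))
      always : ∀ d → Occ T (l ++ u) d → f d ≡ f d₀
      always d occ with Maybe-≡-dec (Maybe-≡-dec _≟_) (f d) (f d₀)
      ... | yes eq = eq
      ... | no ne  = contradiction (d , starts d occ , occ , ne) none
      step : ∀ d₀ → c₀ ≡ d₀ + length l → Occ T l d₀ → (∀ d → Occ T (l ++ u) d → f d ≡ f d₀) → LeftMaximal u c₀
      step zero c₀≡ _ always with preceded c₁ occ₁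
      ... | zero , c₁≡ , _ = contradiction (trans c₀≡ (sym c₁≡)) c₀≢c₁
      ... | suc e , c₁≡ , occ-l = contradiction
        (cong suc (terminated-end⁻ S e (always (suc e) occ-lu))) (<⇒≢ (starts (suc e) occ-lu))
        where
        occ-lu = Occ-++⁺ T l u (suc e) occ-l (subst (Occ T u) c₁≡ occ₁)
      step (suc e) c₀≡ occ-l always
        with x , Te≡ ← <⇒‼-just T e (subst (e <_) (sym (length-terminated S)) (m<n⇒m<1+n (e<n e c₀≡))) =
        extend e (x ∷ l) (trans c₀≡ (sym (+-suc e (length l)))) (grow e Te≡ occ-l) preceded′
        where
        grow : ∀ e → T ‼ e ≡ just x → Occ T l (suc e) → Occ T (x ∷ l) e
        grow e Te≡ occ-l = Occ-++⁺ T [ x ] l e (Occ-[] T x e Te≡) (subst (Occ T l) (+-comm 1 e) occ-l)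
        preceded′ : Preceded (x ∷ l) u
        preceded′ c occ with preceded c occ
        ... | zero , refl , occ-l = contradiction
          (terminated-end⁻ S e (sym (always 0 (Occ-++⁺ T l u 0 occ-l occ)))) (<⇒≢ (e<n e c₀≡))
        ... | suc d , refl , occ-l = d , sym (+-suc d (length l)) ,
          grow d (trans (always (suc d) (Occ-++⁺ T l u (suc d) occ-l occ)) Te≡) occ-l

  record NonRootArc (u x : List M) : Set a where
    field
      P         : List M
      first     : M
      x′        : List M
      x≡        : x ≡ first ∷ x′
      u∼P       : u ∼ P
      extension : ∃ (Represents (P ∷ʳ first))

  -- `u` continues with `b` and with some other `d`. Hence `l ++ u` has an occurrence followed by
  -- `d` and, by left-maximality, one with a different character before it, which is what
  -- `extension-pair` needs.
  nonroot-arc : ∀ {u x v} → IsArc (u , x , v) → u ≢ [] → NonRootArc u x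
  nonroot-arc {x = []} (arc _ _ x≢[] _ _) u≢[] = contradiction refl x≢[]
  nonroot-arc {u} {b ∷ x′} (arc nodeU nodeV _ refl _) u≢[] with c₀ , _ , occ ← infix⇒Occ (node⇒infix nodeV) =
    by-node nodeU
    where
    occ-ub : Occ T (u ∷ʳ b) c₀
    occ-ub = Occ-++⁻ˡ T (u ∷ʳ b) x′ c₀ (subst (λ W → Occ T W c₀) (sym (++-assoc u [ b ] x′)) occ)
    occ₀ : Occ T u c₀
    occ₀ = Occ-++⁻ˡ T u (b ∷ x′) c₀ occ
    c₀+u≤n : c₀ + length u ≤ n
    c₀+u≤n = Occ-∷ʳ-inside u b c₀ occ-ub
    branching : ∀ d → b ≢ d → Infix _≡_ (u ∷ʳ d) T → NonRootArc u (b ∷ x′)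
    branching d b≢d ud with c₁ , _ , occ-ud ← infix⇒Occ ud = record
      { P = P ; first = b ; x′ = x′ ; x≡ = refl ; u∼P = preceded⇒∼ l u u≢[] preceded
      ; extension = pair (preceded c₁ occ₁′) }
      where
      occ₁′ : Occ T u c₁
      occ₁′ = Occ-++⁻ˡ T u [ d ] c₁ occ-ud
      c₀≢c₁ : c₀ ≢ c₁
      c₀≢c₁ refl = b≢d (just-injective (trans (sym (Occ-∷ʳ T u b c₀ occ-ub)) (Occ-∷ʳ T u d c₀ occ-ud)))
      open LeftMaximal (left-maximal u c₀ c₁ u≢[] occ₀ occ₁′ c₀≢c₁ c₀+u≤n)
      P = l ++ u
      occ-Pb : Occ T (P ∷ʳ b) d₀
      occ-Pb = subst (λ W → Occ T W d₀) (sym (++-assoc l u [ b ]))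
        (Occ-++⁺ T l (u ∷ʳ b) d₀ occ-l (subst (Occ T (u ∷ʳ b)) c₀≡ occ-ub))
      pair : (∃ λ d′ → c₁ ≡ d′ + length l × Occ T l d′) → ∃ (Represents (P ∷ʳ b))
      pair (d′ , c₁≡ , occ-l′) = extension-pair P b d₀ d′ d₁ (u≢[] ∘ ++-conicalʳ l u) occ-Pb
        (Occ-++⁺ T l u d′ occ-l′ (subst (Occ T u) c₁≡ occ₁′)) occ₁
        (λ eq → b≢d (just-injective (trans (sym eq) (trans (cong (T ‼_) end≡) (Occ-∷ʳ T u d c₁ occ-ud)))))
        differ
        where
        end≡ : d′ + length P ≡ c₁ + length u
        end≡ = trans (cong (d′ +_) (length-++ l))
          (trans (sym (+-assoc d′ (length l) (length u))) (cong (_+ length u) (sym c₁≡)))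
    by-node : IsNode u → NonRootArc u (b ∷ x′)
    by-node (inj₁ u≡[]) = contradiction u≡[] u≢[]
    -- A leaf ends in the closing delimiter, whereas this occurrence of `u` is followed by `b`.
    by-node (inj₂ (inj₂ (_ , suf))) with c , occ-suf , eq ← suffix⇒Occ suf =
      contradiction (Occ-inside u c₀ u≢[] occ₀ c₀+u≤n c occ-suf)
        (<⇒≱ (≤-reflexive (sym (trans eq (length-terminated S)))))
    by-node (inj₂ (inj₁ (y , z , y≢z , uy , uz))) with Maybe-≡-dec _≟_ b y
    ... | no b≢y   = branching y b≢y uy
    ... | yes refl = branching z y≢z uz

  -- Root arcs and the total number of arcs

  record RootArc (u x : List M) : Set a where
    field
      g      : ℕ
      g∈     : g ∈ G
      first  : M
      x′     : List M
      x≡     : x ≡ first ∷ x′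
      fg≡    : f g ≡ just first

  root-arc : ∀ {u x v} → IsArc (u , x , v) → u ≡ [] → RootArc u x
  root-arc {x = []} (arc _ _ x≢[] _ _) _ = contradiction refl x≢[]
  root-arc {x = b ∷ x′} (arc _ nodeV _ refl _) refl
    with c , _ , occ ← infix⇒Occ (node⇒infix nodeV)
    with Tc≡ ← trans (cong (T ‼_) (sym (+-identityʳ c))) (occ 0 (s≤s z≤n))
    with j , j∈ , Tj≡ ← letter-at-gap c (s≤s⁻¹ (subst (c <_) (length-terminated S) (‼-just⇒< T c Tc≡))) =
    record { g = suc j ; g∈ = j∈ ; first = b ; x′ = x′ ; x≡ = refl ; fg≡ = trans Tj≡ Tc≡ }

  private
    Arc = List M × List M × List M

  number-root-arcs : Number (λ (e : Arc) → IsArc e × proj₁ e ≡ []) _≈_ (λ N → q ^ N ≤ q ^ length G)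
  number-root-arcs = number-via (λ N → q ^ N ≤ q ^ length G) (λ (e , u≡[]) → g (root-arc e u≡[]))
    (λ (e , u≡[]) → g∈ (root-arc e u≡[])) (λ (e , u≡[]) (e′ , u′≡[]) → reflects e u≡[] e′ u′≡[])
    (number-keys q _≟ℕ_ id
      (λ k → number-≤1 (λ N → q ^ N ≤ q) (λ (_ , x≡k) (_ , y≡k) → trans x≡k (sym y≡k))
        (≤-trans (s≤s z≤n) 2≤q) (≤-reflexive (*-identityʳ q))) G id)
    where
    open RootArc
    reflects : ∀ {u x v u′ x′ v′} (e : IsArc (u , x , v)) (u≡[] : u ≡ []) (e′ : IsArc (u′ , x′ , v′)) (u′≡[] : u′ ≡ []) →
               g (root-arc e u≡[]) ≡ g (root-arc e′ u′≡[]) → (u , x , v) ≈ (u′ , x′ , v′)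
    reflects e refl e′ refl g≡ with root-arc e refl | root-arc e′ refl
    ... | record { x≡ = refl ; fg≡ = fg≡ } | record { x≡ = refl ; fg≡ = fg≡′ }
      with refl ← just-injective (trans (sym fg≡) (trans (cong f g≡) fg≡′)) = same-arc ∼-refl e e′

  -- The pair determines `P ∷ʳ first`. From `P` one recovers `u` up to `∼`, and `first` then singles
  -- out the arc by `same-arc`.
  number-nonroot-arcs : Number (λ (e : Arc) → IsArc e × proj₁ e ≢ []) _≈_ (λ N → q ^ N ≤ E)
  number-nonroot-arcs = number-via (λ N → q ^ N ≤ E)
    (λ (e , u≢[]) → proj₁ (extension (nonroot-arc e u≢[]))) (λ _ → tt)
    (λ (e , u≢[]) (e′ , u′≢[]) → reflects e e′ (nonroot-arc e u≢[]) (nonroot-arc e′ u′≢[])) number-pairs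
    where
    open NonRootArc
    reflects : ∀ {u x v u′ x′ v′} → IsArc (u , x , v) → IsArc (u′ , x′ , v′) →
               (r : NonRootArc u x) (r′ : NonRootArc u′ x′) →
               proj₁ (extension r) ≋ proj₁ (extension r′) → (u , x , v) ≈ (u′ , x′ , v′)
    reflects e e′ r@(record { x≡ = refl }) r′@(record { x≡ = refl }) π≋ρ
      with P≡ , refl ← ∷ʳ-injective (P r) (P r′) (represents-injective (extension r) (extension r′) π≋ρ) =
      same-arc (∼-trans (subst (_ ∼_) P≡ (u∼P r)) (∼-sym (u∼P r′))) e e′

  number-arcs : Number IsArc _≈_ (λ N → q ^ N ≤ q ^ length G * E)
  number-arcs = number-split q (q ^ length G) E (λ (u , _) → empty? u) number-root-arcs number-nonroot-arcs
    where
    empty? : ∀ (u : List M) → Dec (u ≡ [])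
    empty? []      = yes refl
    empty? (_ ∷ _) = no λ ()

  -- Both claims reduce to this estimate: the factor `q ^ length G` stands for the arcs leaving the
  -- root in one, and for the summand `z + 1` in the other.
  total-bound : let c = 18 * q * (length Fs + 2) ^ 2 in q ^ length G * E ≤ q ^ c * n ^ c
  total-bound = begin
    q ^ length G * E             ≤⟨ *-monoˡ-≤ E (^-monoˡ-≤ (length G) (m≤m*n q n)) ⟩
    (q * n) ^ length G * E       ≡⟨ cong ((q * n) ^ length G *_) E≡ ⟩
    (q * n) ^ length G * (q * n) ^ (e * (length G * length G))
                                 ≡⟨ ^-distribˡ-+-* (q * n) (length G) _ ⟨
    (q * n) ^ (length G + e * (length G * length G))
                                 ≤⟨ ^-monoʳ-≤ (q * n) exponent ⟩
    (q * n) ^ c                  ≡⟨ ^-distribʳ-* q n c ⟩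
    q ^ c * n ^ c                ∎
    where
    open ≤-Reasoning
    instance
      n≢0 : NonZero n
      n≢0 = >-nonZero (≢[]⇒0<length S≢[])
      q≢0 : NonZero q
      q≢0 = >-nonZero (≤-trans (s≤s z≤n) 2≤q)
      qn≢0 : NonZero (q * n)
      qn≢0 = m*n≢0 q n
    h = length Fs + 2
    c = 18 * q * h ^ 2
    -- Three factors `B`, each with exponent `2q`.
    e = q + q + (q + q + (q + q))
    E≡ : E ≡ (q * n) ^ (e * (length G * length G))
    E≡ = trans (cong (_^ (length G * length G))
      (trans (cong ((q * n) ^ (q + q) *_) (sym (^-distribˡ-+-* (q * n) (q + q) (q + q))))
             (sym (^-distribˡ-+-* (q * n) (q + q) (q + q + (q + q))))))
      (^-*-assoc (q * n) e (length G * length G))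
    g≤h : length G ≤ h
    g≤h = ≤-trans (≤-reflexive (length-gaps 1 Fs)) (≤-trans (n≤1+n _) (≤-reflexive (+-comm 2 (length Fs))))
    h≢0 : NonZero h
    h≢0 = >-nonZero (≤-trans (s≤s z≤n) (m≤n+m 2 (length Fs)))
    exponent : length G + e * (length G * length G) ≤ c
    exponent = begin
      length G + e * (length G * length G)   ≤⟨ +-mono-≤ g≤h (*-monoʳ-≤ e (*-mono-≤ g≤h g≤h)) ⟩
      -- The pairs use up `6q` of the coefficient `18q`; the remaining `12q` absorb the linear term.
      h + e * (h * h)                        ≤⟨ +-monoˡ-≤ (e * (h * h)) 
        (≤-trans (m≤m*n h h {{h≢0}}) (m≤n*m (h * h) (12 * q) {{m*n≢0 12 q}})) ⟩
      12 * q * (h * h) + e * (h * h)         ≡⟨ eighteen q h ⟩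
      c                                      ∎
      where
      eighteen : ∀ q h → 12 * q * (h * h) + (q + q + (q + q + (q + q))) * (h * h) ≡ 18 * q * (h * (h * 1))
      eighteen = solve-∀

theorem2 : ∀ {a} {A : Set a} (_≟_ : DecidableEquality A) (S : List A) (q : ℕ) (Fs : List (List A)) →
    S ≢ [] →
    PowerFree q S →
    IsLZ77 _≟_ S Fs →
    let z = length Fs in
    Number (IsRightExtension _≟_ S) _≡_
    (λ n → n + (z + 1) ≤ 18 * q * (z + 2) ^ 2 ·[1+log q of length S ])
    ×
    Number (CDAWGArc S) (SameCDAWGArc S)
    (λ n → n ≤ 18 * q * (z + 2) ^ 2 ·[1+log q of length S ])
theorem2 _≟_ S q Fs S≢[] free lz =
  (λ xs exts distinct → ≤-trans (right-extensions (length xs) (number-right-extensions xs exts distinct)) total-bound) ,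
  (λ es arcs distinct → ≤-trans (number-arcs es arcs distinct) total-bound)
  where
  open Extensions _≟_ S q Fs S≢[] free lz
  right-extensions : ∀ N → q ^ N ≤ E → q ^ (N + (length Fs + 1)) ≤ q ^ length G * E
  right-extensions N q^N≤E = begin
    q ^ (N + (length Fs + 1))        ≡⟨ ^-distribˡ-+-* q N (length Fs + 1) ⟩
    q ^ N * q ^ (length Fs + 1)      ≡⟨ *-comm (q ^ N) _ ⟩
    q ^ (length Fs + 1) * q ^ N      ≡⟨ cong (λ g → q ^ g * q ^ N)
      (trans (+-comm (length Fs) 1) (sym (length-gaps 1 Fs))) ⟩
    q ^ length G * q ^ N             ≤⟨ *-monoʳ-≤ (q ^ length G) q^N≤E ⟩
    q ^ length G * E                 ∎
    where open ≤-Reasoning
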